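{- If $H_{20}$ is an anti-twinned signified graph on $20$ vertices such that every signified graph whose underlying graph is planar admits a signified homomorphism to $H_{20}$, then $H_{20}$ is isomorphic (by a sign-preserving isomorphism) to $Tr(SP_9)$.
   Context: A signified graph $(G,\Sigma)$ is a simple graph $G$ with a set $\Sigma\subseteq E(G)$ of negative edges, other edges positive. A signified homomorphism is a vertex map sending every edge to an edge of the same sign. For a signified graph $(H,\Lambda)$, $AT(H,\Lambda)$ has vertex set $\{u_0,u_1:u\in V(H)\}$; for every edge $uv$ of $H$ it has edges $u_0v_0,u_1v_1$ with the sign of $uv$ and $u_0v_1,u_1v_0$ with the opposite sign; no other edges. A signified graph is anti-twinned if it is isomorphic to $AT(H,\Lambda)$ for some signified graph $(H,\Lambda)$. $SP_9$ is the complete graph on $\mathbb{F}_9$ where $xy$ is negative iff $y-x$ is a non-square in $\mathbb{F}_9$; $SP_9^+$ is $SP_9$ plus a new vertex joined by positive edges to all nine vertices; and $Tr(SP_9)=AT(SP_9^+)$ (20 vertices). -}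

module Defs where

open import Data.Bool.Base using (if_then_else_)
open import Data.Fin.Base using (Fin; toℕ; _<_)
open import Data.Fin.Properties as Fin using (any?; all?)
open import Data.List.Base using (List; []; _∷_)
open import Data.Maybe.Base as Maybe using (Maybe; just; nothing)
import Data.Maybe.Properties as Maybe
open import Data.Nat.Base as ℕ using (ℕ)
open import Data.Nat.DivMod using (_mod_)
open import Data.Product.Base using (Σ-syntax; ∃-syntax; _×_; _,_)
open import Data.Product.Properties using (≡-dec)
open import Data.Rational.Base as ℚ using (ℚ; 0ℚ; 1ℚ)
open import Data.Sign.Base as Sign using (Sign; opposite)
import Data.Sign.Properties as Sign
open import Data.Sum.Base using (_⊎_)
open import Function.Bundles using (_↔_; Inverse)
open import Function.Definitions using (Injective)
open import Relation.Binary.Definitions using (Symmetric; DecidableEquality)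
open import Relation.Binary.PropositionalEquality
  using (_≡_; _≢_; refl; sym; trans; cong)
open import Relation.Nullary.Decidable using (Dec; does; from-yes)
open import Relation.Nullary.Negation using (¬_)

------------------------------------------------------------------------
-- Simple graphs and signified graphs

record SimpleGraph (V : Set) : Set₁ where
  field
    Adj       : V → V → Set
    symmetric : Symmetric Adj
    loopless  : ∀ x → ¬ Adj x x

-- The pair (G , Σ) is encoded by one function: `nothing` for a non-edge
-- of G, `just Sign.-` for an edge in Σ, `just Sign.+` for an edge
-- outside Σ.

record SignifiedGraph (V : Set) : Set where
  field
    sign      : V → V → Maybe Sign
    symmetric : ∀ x y → sign x y ≡ sign y x
    loopless  : ∀ x → sign x x ≡ nothing

open SignifiedGraph using (sign)

underlying : {V : Set} → SignifiedGraph V → SimpleGraph V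
underlying G = record
  { Adj       = λ x y → ∃[ s ] sign G x y ≡ just s
  ; symmetric = λ {x} {y} (s , e) → s , trans (SignifiedGraph.symmetric G y x) e
  ; loopless  = λ x (s , e) → nothing≢just (trans (sym (SignifiedGraph.loopless G x)) e)
  }
  where
  nothing≢just : ∀ {s : Sign} → nothing ≢ just s
  nothing≢just ()

infix 4 _⟶_ _≅_

_⟶_ : {V W : Set} → SignifiedGraph V → SignifiedGraph W → Set
_⟶_ {V} {W} G H =
  Σ[ f ∈ (V → W) ] (∀ x y s → sign G x y ≡ just s → sign H (f x) (f y) ≡ just s)

_≅_ : {V W : Set} → SignifiedGraph V → SignifiedGraph W → Set
_≅_ {V} {W} G H =
  Σ[ φ ∈ V ↔ W ] (∀ x y → sign H (Inverse.to φ x) (Inverse.to φ y) ≡ sign G x y)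

------------------------------------------------------------------------
-- Planarity: existence of a drawing in the plane whose edges are
-- polygonal arcs.  Coordinates are rational; since the drawings are of
-- finite graphs, breakpoints can be perturbed, so this allows the same
-- graphs as real coordinates.  Comparing only rational points of the arcs
-- loses nothing: if two segments with rational end points meet in ℝ²,
-- they meet in a rational point, and if they share more than one point,
-- they share infinitely many rational ones.

Point : Set
Point = ℚ × ℚ

affine : ℚ → Point → Point → Point
affine t (a₁ , a₂) (b₁ , b₂) = mix a₁ b₁ , mix a₂ b₂
  where
  mix : ℚ → ℚ → ℚ
  mix a b = (1ℚ ℚ.- t) ℚ.* a ℚ.+ t ℚ.* b

OnSegment : Point → Point → Point → Set
OnSegment p a b = ∃[ t ] 0ℚ ℚ.≤ t × t ℚ.≤ 1ℚ × p ≡ affine t a b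

-- The polygonal path from a to b with the listed breakpoints in between.

OnPath : Point → Point → List Point → Point → Set
OnPath p a []       b = OnSegment p a b
OnPath p a (c ∷ cs) b = OnSegment p a c ⊎ OnPath p c cs b

-- The path does not degenerate or meet itself.

IsArc : Point → List Point → Point → Set
IsArc a []       b = a ≢ b
IsArc a (c ∷ cs) b =
  a ≢ c × IsArc c cs b × (∀ p → OnSegment p a c → OnPath p c cs b → p ≡ c)

module _ {n : ℕ} (G : SimpleGraph (Fin n)) where

  open SimpleGraph G

  -- Each edge {u , v} is drawn once, from its smaller end u to its larger
  -- end v.

  Edge : Fin n → Fin n → Set
  Edge u v = u < v × Adj u v

  record Drawing : Set where
    field
      pos   : Fin n → Point
      bends : Fin n → Fin n → List Point

    OnEdge : Point → Fin n → Fin n → Set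
    OnEdge p u v = OnPath p (pos u) (bends u v) (pos v)

    field
      pos-injective : Injective _≡_ _≡_ pos
      edge-arc      : ∀ u v → Edge u v → IsArc (pos u) (bends u v) (pos v)
      edge-vertex   : ∀ u v w → Edge u v → OnEdge (pos w) u v → w ≡ u ⊎ w ≡ v
      -- With edge-vertex, such a common point is a common end.
      edge-edge     : ∀ u v u′ v′ → Edge u v → Edge u′ v′ → (u , v) ≢ (u′ , v′) →
                      ∀ p → OnEdge p u v → OnEdge p u′ v′ → ∃[ w ] p ≡ pos w

  Planar : Set
  Planar = Drawing

------------------------------------------------------------------------
-- Anti-twinned graphs

twinSign : Fin 2 → Fin 2 → Sign → Sign
twinSign i j s = if does (i Fin.≟ j) then s else opposite s

twinSign-comm : ∀ i j s → twinSign i j s ≡ twinSign j i s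
twinSign-comm Fin.zero           Fin.zero           s = refl
twinSign-comm Fin.zero           (Fin.suc Fin.zero) s = refl
twinSign-comm (Fin.suc Fin.zero) Fin.zero           s = refl
twinSign-comm (Fin.suc Fin.zero) (Fin.suc Fin.zero) s = refl

-- The vertex (u , i) is uᵢ.

AT : {V : Set} → SignifiedGraph V → SignifiedGraph (V × Fin 2)
AT {V} H = record
  { sign      = s
  ; symmetric = s-sym
  ; loopless  = λ (u , i) → cong (Maybe.map (twinSign i i)) (SignifiedGraph.loopless H u)
  }
  where
  s : V × Fin 2 → V × Fin 2 → Maybe Sign
  s (u , i) (v , j) = Maybe.map (twinSign i j) (sign H u v)

  s-sym : ∀ x y → s x y ≡ s y x
  s-sym (u , i) (v , j) = trans
    (cong (Maybe.map (twinSign i j)) (SignifiedGraph.symmetric H u v))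
    (Maybe.map-cong (twinSign-comm i j) (sign H v u))

AntiTwinned : {V : Set} → SignifiedGraph V → Set
AntiTwinned G = ∃[ m ] Σ[ H ∈ SignifiedGraph (Fin m) ] G ≅ AT H

------------------------------------------------------------------------
-- The graph Tr(SP₉)

-- -1 is not a square in 𝔽₃, so 𝔽₉ = 𝔽₃[i] with i² = -1, and (a , b)
-- stands for a + b i.  In the formulas below, 2 plays the role of -1.

𝔽₉ : Set
𝔽₉ = Fin 3 × Fin 3

infixl 6 _⊖_
infixl 7 _⊗_

_⊖_ : 𝔽₉ → 𝔽₉ → 𝔽₉
(a , b) ⊖ (c , d) =
  (toℕ a ℕ.+ 2 ℕ.* toℕ c) mod 3 , (toℕ b ℕ.+ 2 ℕ.* toℕ d) mod 3

_⊗_ : 𝔽₉ → 𝔽₉ → 𝔽₉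
(a , b) ⊗ (c , d) =
  (toℕ a ℕ.* toℕ c ℕ.+ 2 ℕ.* (toℕ b ℕ.* toℕ d)) mod 3 ,
  (toℕ a ℕ.* toℕ d ℕ.+ toℕ b ℕ.* toℕ c) mod 3

_≟₉_ : DecidableEquality 𝔽₉
_≟₉_ = ≡-dec Fin._≟_ Fin._≟_

IsSquare : 𝔽₉ → Set
IsSquare x = ∃[ a ] ∃[ b ] (a , b) ⊗ (a , b) ≡ x

isSquare? : ∀ x → Dec (IsSquare x)
isSquare? x = any? λ a → any? λ b → ((a , b) ⊗ (a , b)) ≟₉ x

SP₉ : SignifiedGraph 𝔽₉
SP₉ = record
  { sign      = s
  ; symmetric = λ (a , b) (c , d) → s-sym a b c d
  ; loopless  = λ (a , b) → s-irr a b
  }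
  where
  s : 𝔽₉ → 𝔽₉ → Maybe Sign
  s x y = if does (x ≟₉ y) then nothing
          else just (if does (isSquare? (y ⊖ x)) then Sign.+ else Sign.-)

  _≟ₛ_ : DecidableEquality (Maybe Sign)
  _≟ₛ_ = Maybe.≡-dec Sign._≟_

  s-sym : ∀ a b c d → s (a , b) (c , d) ≡ s (c , d) (a , b)
  s-sym = from-yes (all? λ a → all? λ b → all? λ c → all? λ d →
            s (a , b) (c , d) ≟ₛ s (c , d) (a , b))

  s-irr : ∀ a b → s (a , b) (a , b) ≡ nothing
  s-irr = from-yes (all? λ a → all? λ b → s (a , b) (a , b) ≟ₛ nothing)

-- In Maybe V, the vertex `nothing` is the new one.

_⁺ : {V : Set} → SignifiedGraph V → SignifiedGraph (Maybe V)
_⁺ {V} G = record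
  { sign      = s
  ; symmetric = s-sym
  ; loopless  = s-irr
  }
  where
  s : Maybe V → Maybe V → Maybe Sign
  s (just x) (just y) = sign G x y
  s (just x) nothing  = just Sign.+
  s nothing  (just y) = just Sign.+
  s nothing  nothing  = nothing

  s-sym : ∀ x y → s x y ≡ s y x
  s-sym (just x) (just y) = SignifiedGraph.symmetric G x y
  s-sym (just x) nothing  = refl
  s-sym nothing  (just y) = refl
  s-sym nothing  nothing  = refl

  s-irr : ∀ x → s x x ≡ nothing
  s-irr (just x) = SignifiedGraph.loopless G x
  s-irr nothing  = refl

TrSP₉ : SignifiedGraph (Maybe 𝔽₉ × Fin 2)
TrSP₉ = AT (SP₉ ⁺)

{-# OPTIONS --safe #-}
module Submission where

-- Next to an edge uv of a planar graph one can draw a path all of whose vertices are joined to both u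
-- and v.  If its edges are alternately positive and negative, the image of five consecutive vertices
-- contains four distinct ones, so a path of ten vertices, all of them positive neighbours of u, five
-- positive and five negative neighbours of v, is mapped to at least eight vertices.  An anti-twinned
-- target on 20 vertices has only eight pairs of twins besides those of the images of u and v, and a
-- positive neighbourhood contains at most one vertex of each pair.  So the path reaches all of them,
-- four with either sign.  Repeating the construction inside the triangles that arise shows, for
-- H₂₀ = AT H, that any two rows of the sign matrix of H are orthogonal: it is a symmetric conference
-- matrix of order 10, and up to switching and renumbering that of SP₉⁺ is the only one.

open import Defs
open import Data.Bool.Base using (Bool; true; false; _∧_; not; if_then_else_)
open import Data.Fin.Base as Fin using (Fin; zero; suc; punchOut)
open import Data.Fin.Patterns
import Data.Fin.Properties as Fin
open import Data.Integer.Base using (1ℤ)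
open import Data.List.Base as List
  using (List; []; _∷_; _++_; _∷ʳ_; tabulate; allFin; filter; filterᵇ; length)
import Data.List.Properties as List
open import Data.List.Membership.Propositional using (_∈_)
open import Data.List.Membership.Propositional.Properties using (∈-filter⁺; ∈-allFin)
open import Data.List.Relation.Unary.All as All using (All; []; _∷_)
import Data.List.Relation.Unary.All.Properties as All
import Data.List.Relation.Unary.Any as Any
open import Data.List.Relation.Unary.Any.Properties using (lookup-index)
open import Data.Maybe.Base as Maybe using (Maybe; just; nothing; zipWith; fromMaybe)
import Data.Maybe.Properties as Maybe
open import Data.Nat.Base as ℕ using (ℕ; zero; suc)
import Data.Nat.Properties as ℕ
open import Data.Product.Base using (Σ-syntax; ∃-syntax; _×_; _,_; proj₁; proj₂; map₂)
open import Data.Product.Properties using (≡-dec)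
open import Data.Rational.Base as ℚ using (ℚ; 0ℚ; 1ℚ; _+_; _*_; _-_; _<_; _≤_)
import Data.Rational.Properties as ℚ
open import Data.Rational.Solver using (module +-*-Solver)
open import Data.Sign.Base as Sign using (Sign; opposite)
import Data.Sign.Properties as Sign
open import Data.Sum.Base as Sum using (_⊎_; inj₁; inj₂; [_,_]′)
open import Data.Sum.Function.Propositional using (_⊎-↔_)
open import Data.Unit.Base using (⊤; tt)
open import Data.Vec.Base using (Vec; []; _∷_; lookup)
open import Data.Vec.Relation.Unary.All using ([]; _∷_)
open import Data.Vec.Relation.Unary.AllPairs.Core using ([]; _∷_)
open import Data.Vec.Relation.Unary.Unique.Propositional using (Unique)
open import Data.Vec.Relation.Unary.Unique.Propositional.Properties using (lookup-injective)
open import Function.Base using (_∘_)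
open import Function.Bundles using (_↔_; Inverse; Injection; mk↔ₛ′)
open import Function.Definitions using (Injective)
open import Function.Properties.Inverse using (↔-refl; ↔-sym; ↔-trans; ↔⇒↣)
open import Relation.Binary.Definitions using (DecidableEquality; tri<; tri≈; tri>)
open import Relation.Binary.PropositionalEquality
open import Relation.Nullary.Decidable
  using (Dec; yes; no; does; from-yes; ¬?; _×-dec_; _→-dec_)
open import Relation.Nullary.Negation using (¬_; contradiction)
open import Relation.Unary using (Decidable)

open SignifiedGraph using (sign)
open +-*-Solver using (solve; _:=_; _:+_; _:*_; _:-_; con)

-- Stacked triangulations

-- node ℓ ch inserts a vertex into a triangle, joins it to corner i with sign ℓ i, and continues with
-- ch k in the triangle whose corner k is replaced by the new vertex.
data Tree : Set where
  leaf : Tree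
  node : (Fin 3 → Sign) → (Fin 3 → Tree) → Tree

data Pos : Tree → Set where
  here  : ∀ {ℓ ch} → Pos (node ℓ ch)
  there : ∀ {ℓ ch} k → Pos (ch k) → Pos (node ℓ ch)

Vert : Tree → Set
Vert t = Fin 3 ⊎ Pos t

-- The outer corner `k` is not a corner of the `k`-th inner triangle and so has no neighbours inside
-- it; the other two corners are kept.
cornerSign : ∀ {t} → Fin 3 → Pos t → Maybe Sign
cornerSign {node ℓ _} i here        = just (ℓ i)
cornerSign            i (there k p) = if does (i Fin.≟ k) then nothing else cornerSign i p

innerSign : ∀ {t} → Pos t → Pos t → Maybe Sign
innerSign here        here        = nothing
-- The inserted vertex takes over the place of corner `k` in the `k`-th triangle.
innerSign here        (there k p) = cornerSign k p
innerSign (there k p) here        = cornerSign k p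
innerSign (there k p) (there l q) with k Fin.≟ l
... | yes refl = innerSign p q
... | no _     = nothing

innerSign-sym : ∀ {t} (p q : Pos t) → innerSign p q ≡ innerSign q p
innerSign-sym here        here        = refl
innerSign-sym here        (there _ _) = refl
innerSign-sym (there _ _) here        = refl
innerSign-sym (there k p) (there l q) with k Fin.≟ l | l Fin.≟ k
... | yes refl | yes refl = innerSign-sym p q
... | no _     | no _     = refl
... | yes refl | no k≢k   = contradiction refl k≢k
... | no k≢k   | yes refl = contradiction refl k≢k

innerSign-irr : ∀ {t} (p : Pos t) → innerSign p p ≡ nothing
innerSign-irr here        = refl
innerSign-irr (there k p) with k Fin.≟ k
... | yes refl = innerSign-irr p
... | no _     = refl

-- The corners of the outer triangle, inj₁ i, are not joined to each other.
stacked : (t : Tree) → SignifiedGraph (Vert t)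
stacked t = record
  { sign      = s
  ; symmetric = s-sym
  ; loopless  = λ { (inj₁ _) → refl ; (inj₂ p) → innerSign-irr p }
  }
  where
  s : Vert t → Vert t → Maybe Sign
  s (inj₁ _) (inj₁ _) = nothing
  s (inj₁ i) (inj₂ q) = cornerSign i q
  s (inj₂ p) (inj₁ j) = cornerSign j p
  s (inj₂ p) (inj₂ q) = innerSign p q

  s-sym : ∀ x y → s x y ≡ s y x
  s-sym (inj₁ _) (inj₁ _) = refl
  s-sym (inj₁ _) (inj₂ _) = refl
  s-sym (inj₂ _) (inj₁ _) = refl
  s-sym (inj₂ p) (inj₂ q) = innerSign-sym p q

-- A straight-line drawing in barycentric coordinates

lift : ∀ {ℓ ch} k → Vert (ch k) → Vert (node ℓ ch)
lift k (inj₁ i) = if does (i Fin.≟ k) then inj₂ here else inj₁ i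
lift k (inj₂ p) = inj₂ (there k p)

-- Every edge joins some p to a corner of the triangle into which p was inserted.
foot : ∀ {t} → Pos t → Fin 3 → Vert t
foot here        i = inj₁ i
foot (there k p) i = lift k (foot p i)

lift-same : ∀ {ℓ ch} k → lift {ℓ} {ch} k (inj₁ k) ≡ inj₂ here
lift-same k with k Fin.≟ k
... | yes _  = refl
... | no k≢k = contradiction refl k≢k

lift-other : ∀ {ℓ ch i k} → i ≢ k → lift {ℓ} {ch} k (inj₁ i) ≡ inj₁ i
lift-other {i = i} {k} i≢k with i Fin.≟ k
... | yes i≡k = contradiction i≡k i≢k
... | no _    = refl

cornerSign⇒foot : ∀ {t} i (p : Pos t) {s} → cornerSign i p ≡ just s → ∃[ j ] foot p j ≡ inj₁ i
cornerSign⇒foot i here        _ = i , refl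
cornerSign⇒foot i (there k p) e with i Fin.≟ k
... | no i≢k with j , f ← cornerSign⇒foot i p e = j , trans (cong (lift k) f) (lift-other i≢k)

innerSign⇒foot : ∀ {t} (p q : Pos t) {s} → innerSign p q ≡ just s →
                 (∃[ j ] foot p j ≡ inj₂ q) ⊎ (∃[ j ] foot q j ≡ inj₂ p)
innerSign⇒foot here        (there k q) e with j , f ← cornerSign⇒foot k q e =
  inj₂ (j , trans (cong (lift k) f) (lift-same k))
innerSign⇒foot (there k p) here        e with j , f ← cornerSign⇒foot k p e =
  inj₁ (j , trans (cong (lift k) f) (lift-same k))
innerSign⇒foot (there k p) (there l q) e with k Fin.≟ l
... | yes refl = Sum.map (map₂ (cong (lift k))) (map₂ (cong (lift k))) (innerSign⇒foot p q e)

-- Both orientations are allowed, since a drawing orders the vertices independently of the tree.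
Ends : ∀ {t} → Pos t → Fin 3 → Vert t → Vert t → Set
Ends p j x y = x ≡ inj₂ p × y ≡ foot p j ⊎ y ≡ inj₂ p × x ≡ foot p j

edge⇒ends : ∀ {t} x y {s} → sign (stacked t) x y ≡ just s → ∃[ p ] ∃[ j ] Ends p j x y
edge⇒ends (inj₁ i) (inj₂ q) e with j , f ← cornerSign⇒foot i q e = q , j , inj₂ (refl , sym f)
edge⇒ends (inj₂ p) (inj₁ i) e with j , f ← cornerSign⇒foot i p e = p , j , inj₁ (refl , sym f)
edge⇒ends (inj₂ p) (inj₂ q) e with innerSign⇒foot p q e
... | inj₁ (j , f) = p , j , inj₁ (refl , sym f)
... | inj₂ (j , f) = q , j , inj₂ (refl , sym f)

Bary : Set
Bary = Fin 3 → ℚ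

unit : Fin 3 → Bary
unit i j = if does (i Fin.≟ j) then 1ℚ else 0ℚ

⅓ : ℚ
⅓ = 1ℤ ℚ./ 3

-- The affine map onto the triangle whose k-th corner is moved to the centre.
shrink : Fin 3 → Bary → Bary
shrink k x i = if does (k Fin.≟ i) then ⅓ * x k else x i + ⅓ * x k

inner : ∀ {t} → Pos t → Bary
inner here        = λ _ → ⅓
inner (there k p) = shrink k (inner p)

bary : ∀ {t} → Vert t → Bary
bary (inj₁ i) = unit i
bary (inj₂ p) = inner p

mix : ℚ → ℚ → ℚ → ℚ
mix t a b = (1ℚ - t) * a + t * b

shrink-same : ∀ k x → shrink k x k ≡ ⅓ * x k
shrink-same k x with k Fin.≟ k
... | yes _  = refl
... | no k≢k = contradiction refl k≢k

shrink-other : ∀ {k i} x → k ≢ i → shrink k x i ≡ x i + ⅓ * x k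
shrink-other {k} {i} x k≢i with k Fin.≟ i
... | yes k≡i = contradiction k≡i k≢i
... | no _    = refl

shrink-injective : ∀ k {x y} → shrink k x ≗ shrink k y → x ≗ y
shrink-injective k {x} {y} eq i with k Fin.≟ i
... | yes refl = begin
  x k                          ≡⟨ triple (x k) ⟩
  (1ℚ + 1ℚ + 1ℚ) * (⅓ * x k)   ≡⟨ cong ((1ℚ + 1ℚ + 1ℚ) *_) (same x y eq) ⟩
  (1ℚ + 1ℚ + 1ℚ) * (⅓ * y k)   ≡⟨ triple (y k) ⟨
  y k                          ∎
  where
  open ≡-Reasoning
  same : ∀ x y → shrink k x ≗ shrink k y → ⅓ * x k ≡ ⅓ * y k
  same x y eq = trans (sym (shrink-same k x)) (trans (eq k) (shrink-same k y))
  triple : ∀ a → a ≡ (1ℚ + 1ℚ + 1ℚ) * (⅓ * a)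
  triple = solve 1 (λ a → a := con (1ℚ + 1ℚ + 1ℚ) :* (con ⅓ :* a)) refl
... | no k≢i = begin
  x i                               ≡⟨ difference (x i) (x k) ⟩
  (x i + ⅓ * x k) - ⅓ * x k         ≡⟨ cong₂ _-_ (shrink-other x k≢i) (shrink-same k x) ⟨
  shrink k x i - shrink k x k       ≡⟨ cong₂ _-_ (eq i) (eq k) ⟩
  shrink k y i - shrink k y k       ≡⟨ cong₂ _-_ (shrink-other y k≢i) (shrink-same k y) ⟩
  (y i + ⅓ * y k) - ⅓ * y k         ≡⟨ difference (y i) (y k) ⟨
  y i                               ∎
  where
  open ≡-Reasoning
  difference : ∀ a b → a ≡ (a + ⅓ * b) - ⅓ * b
  difference = solve 2 (λ a b → a := (a :+ con ⅓ :* b) :- con ⅓ :* b) refl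

shrink-mix : ∀ k t x y → (λ i → mix t (shrink k x i) (shrink k y i)) ≗ shrink k (λ i → mix t (x i) (y i))
shrink-mix k t x y i with does (k Fin.≟ i)
... | true  =
  solve 3 (λ t a b → (con 1ℚ :- t) :* (con ⅓ :* a) :+ t :* (con ⅓ :* b)
                     := con ⅓ :* ((con 1ℚ :- t) :* a :+ t :* b))
          refl t (x k) (y k)
... | false =
  solve 5 (λ t a b c d → (con 1ℚ :- t) :* (a :+ con ⅓ :* b) :+ t :* (c :+ con ⅓ :* d)
                         := ((con 1ℚ :- t) :* a :+ t :* c) :+ con ⅓ :* ((con 1ℚ :- t) :* b :+ t :* d))
          refl t (x i) (x k) (y i) (y k)

bary-lift : ∀ {ℓ ch} k (x : Vert (ch k)) → bary (lift {ℓ} {ch} k x) ≗ shrink k (bary x)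
bary-lift {ℓ} {ch} k (inj₁ i) j = corners k i j
  where
  corners : ∀ k i j → bary (lift {ℓ} {ch} k (inj₁ i)) j ≡ shrink k (unit i) j
  corners = from-yes (Fin.all? λ k → Fin.all? λ i → Fin.all? λ j →
              bary (lift {ℓ} {ch} k (inj₁ i)) j ℚ.≟ shrink k (unit i) j)
bary-lift k (inj₂ p) j = refl

-- On p nothing is the position of p, On p (just j) the open segment from p to its j-th foot.
On : ∀ {t} → Pos t → Maybe (Fin 3) → Bary → Set
On p nothing  q = q ≗ inner p
On p (just j) q = ∃[ s ] 0ℚ < s × s < 1ℚ × (∀ i → q i ≡ mix s (inner p i) (bary (foot p j) i))

On-resp : ∀ {t} (p : Pos t) c {q r} → q ≗ r → On p c q → On p c r
On-resp p nothing  q≗r on = λ i → trans (sym (q≗r i)) (on i)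
On-resp p (just j) q≗r (s , 0<s , s<1 , on) = s , 0<s , s<1 , λ i → trans (sym (q≗r i)) (on i)

-- `shrink k` is affine and carries the corners to those of the `k`-th inner triangle, so it carries
-- the drawing of the subtree onto that part of the whole drawing. The inductions on positions rest
-- on this.
On-there : ∀ {ℓ ch} k (p : Pos (ch k)) c {q} → On {node ℓ ch} (there k p) c q →
           Σ[ r ∈ Bary ] On p c r × q ≗ shrink k r
On-there k p nothing  on = inner p , (λ _ → refl) , on
On-there {ch = ch} k p (just j) (s , 0<s , s<1 , on) =
  (λ i → mix s (inner p i) (bary (foot p j) i)) , (s , 0<s , s<1 , λ _ → refl) ,
  λ i → trans (on i) (trans (cong (mix s (shrink k (inner p) i)) (bary-lift {ch = ch} k (foot p j) i))
                            (shrink-mix k s (inner p) (bary (foot p j)) i))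

0<⅓* : ∀ {a} → 0ℚ < a → 0ℚ < ⅓ * a
0<⅓* 0<a = ℚ.*-monoʳ-<-pos ⅓ 0<a

-- Coordinate `i` exceeds coordinate `k` by exactly `x i`.
shrink-min : ∀ {k i x} → 0ℚ < x i → k ≢ i → shrink k x k < shrink k x i
shrink-min {k} {i} {x} 0<x k≢i = subst₂ _<_
  (trans (ℚ.+-identityˡ _) (sym (shrink-same k x))) (sym (shrink-other x k≢i))
  (ℚ.+-monoˡ-< (⅓ * x k) 0<x)

shrink-pos : ∀ k {x} → (∀ i → 0ℚ < x i) → ∀ i → 0ℚ < shrink k x i
shrink-pos k 0<x i with does (k Fin.≟ i)
... | true  = 0<⅓* (0<x k)
... | false = ℚ.+-mono-< (0<x i) (0<⅓* (0<x k))

unit-same : ∀ j → unit j j ≡ 1ℚ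
unit-same j with j Fin.≟ j
... | yes _  = refl
... | no j≢j = contradiction refl j≢j

unit-other : ∀ {j i} → j ≢ i → unit j i ≡ 0ℚ
unit-other {j} {i} j≢i with j Fin.≟ i
... | yes j≡i = contradiction j≡i j≢i
... | no _    = refl

0≤unit : ∀ j i → 0ℚ ≤ unit j i
0≤unit j i with does (j Fin.≟ i)
... | true  = ℚ.nonNegative⁻¹ 1ℚ
... | false = ℚ.≤-refl

p<q⇒0<q-p : ∀ {p q} → p < q → 0ℚ < q - p
p<q⇒0<q-p {p} {q} p<q = subst (_< q - p) (ℚ.+-inverseʳ p) (ℚ.+-monoˡ-< (ℚ.- p) p<q)

mix-monoʳ-≤ : ∀ {s} a {b c} → 0ℚ < s → b ≤ c → mix s a b ≤ mix s a c
mix-monoʳ-≤ {s} a 0<s b≤c = ℚ.+-monoʳ-≤ ((1ℚ - s) * a)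
  (ℚ.*-monoˡ-≤-nonNeg s {{ℚ.pos⇒nonNeg s {{ℚ.positive 0<s}}}} b≤c)

mix-monoʳ-< : ∀ {s} a {b c} → 0ℚ < s → b < c → mix s a b < mix s a c
mix-monoʳ-< {s} a 0<s b<c = ℚ.+-monoʳ-< ((1ℚ - s) * a) (ℚ.*-monoʳ-<-pos s {{ℚ.positive 0<s}} b<c)

0<mix : ∀ {s a b} → 0ℚ < s → s < 1ℚ → 0ℚ < a → 0ℚ ≤ b → 0ℚ < mix s a b
0<mix {s} {a} {b} 0<s s<1 0<a 0≤b = ℚ.<-≤-trans
  (subst (0ℚ <_) (sym (trans (cong ((1ℚ - s) * a +_) (ℚ.*-zeroʳ s)) (ℚ.+-identityʳ _)))
    (subst (_< (1ℚ - s) * a) (ℚ.*-zeroʳ (1ℚ - s))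
      (ℚ.*-monoʳ-<-pos (1ℚ - s) {{ℚ.positive (p<q⇒0<q-p s<1)}} 0<a)))
  (mix-monoʳ-≤ a 0<s 0≤b)

-- An open segment from an interior point stays in the interior even when it ends at a corner.
On⇒0< : ∀ {t} (p : Pos t) c {q} → On p c q → ∀ i → 0ℚ < q i
On⇒0< here nothing  on i = subst (0ℚ <_) (sym (on i)) (ℚ.positive⁻¹ ⅓)
On⇒0< here (just j) (s , 0<s , s<1 , on) i =
  subst (0ℚ <_) (sym (on i)) (0<mix 0<s s<1 (ℚ.positive⁻¹ ⅓) (0≤unit j i))
On⇒0< (there k p) c on i with r , on′ , q≗r ← On-there k p c on =
  subst (0ℚ <_) (sym (q≗r i)) (shrink-pos k (On⇒0< p c on′) i)

-- This separates the three inner triangles from one another and, with `here-min`, from the inserted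
-- vertex and its edges.
there-min : ∀ {ℓ ch} k (p : Pos (ch k)) c {q i} → On {node ℓ ch} (there k p) c q → k ≢ i → q k < q i
there-min k p c {i = i} on k≢i with r , on′ , q≗r ← On-there k p c on =
  subst₂ _<_ (sym (q≗r k)) (sym (q≗r i)) (shrink-min {x = r} (On⇒0< p c on′ i) k≢i)

-- This tells the three edges of the inserted vertex apart, and also from the vertex itself, where
-- all coordinates are equal.
spoke-max : ∀ {ℓ ch} j {q i} → On {node ℓ ch} here (just j) q → j ≢ i → q i < q j
spoke-max j {i = i} (s , 0<s , _ , on) j≢i = subst₂ _<_ (sym (on i)) (sym (on j))
  (mix-monoʳ-< ⅓ 0<s (subst₂ _<_ (sym (unit-other j≢i)) (sym (unit-same j)) (ℚ.positive⁻¹ 1ℚ)))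

avoid : (i j : Fin 3) → ∃[ k ] i ≢ k × j ≢ k
avoid 0F 0F = 1F , (λ ()) , (λ ())
avoid 0F 1F = 2F , (λ ()) , (λ ())
avoid 0F 2F = 1F , (λ ()) , (λ ())
avoid 1F 0F = 2F , (λ ()) , (λ ())
avoid 1F 1F = 0F , (λ ()) , (λ ())
avoid 1F 2F = 0F , (λ ()) , (λ ())
avoid 2F 0F = 1F , (λ ()) , (λ ())
avoid 2F 1F = 0F , (λ ()) , (λ ())
avoid 2F 2F = 0F , (λ ()) , (λ ())

-- The smallest coordinate of a point of On here is attained twice.
here-min : ∀ {ℓ ch} c {q} → On {node ℓ ch} here c q → ∀ k → ∃[ i ] k ≢ i × q i ≤ q k
here-min nothing on k with i , k≢i , _ ← avoid k k =
  i , k≢i , ℚ.≤-reflexive (trans (on i) (sym (on k)))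
here-min (just j) (s , 0<s , _ , on) k with i , k≢i , j≢i ← avoid k j =
  i , k≢i , subst₂ _≤_ (sym (on i)) (sym (on k))
    (mix-monoʳ-≤ ⅓ 0<s (subst (_≤ unit j k) (sym (unit-other j≢i)) (0≤unit j k)))

here≢there : ∀ {ℓ ch} k (p : Pos (ch k)) c c′ {q} →
             On {node ℓ ch} here c q → ¬ On {node ℓ ch} (there k p) c′ q
here≢there k p c c′ on on′ with i , k≢i , qᵢ≤qₖ ← here-min c on k =
  ℚ.<-irrefl refl (ℚ.<-≤-trans (there-min k p c′ on′ k≢i) qᵢ≤qₖ)

-- By there-min, a point of an inner triangle has a unique smallest coordinate, which tells the triangle.
On-unique : ∀ {t} (p p′ : Pos t) c c′ {q} → On p c q → On p′ c′ q → (p , c) ≡ (p′ , c′)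
On-unique (here {ℓ} {ch}) here nothing  nothing   on on′ = refl
On-unique (here {ℓ} {ch}) here nothing  (just j)  on on′ with i , j≢i , _ ← avoid j j =
  contradiction (trans (on i) (sym (on j))) (ℚ.<⇒≢ (spoke-max {ℓ} {ch} j on′ j≢i))
On-unique (here {ℓ} {ch}) here (just j) nothing   on on′ with i , j≢i , _ ← avoid j j =
  contradiction (trans (on′ i) (sym (on′ j))) (ℚ.<⇒≢ (spoke-max {ℓ} {ch} j on j≢i))
On-unique (here {ℓ} {ch}) here (just j) (just j′) on on′ with j Fin.≟ j′
... | yes refl = refl
... | no j≢j′  = contradiction (spoke-max {ℓ} {ch} j on j≢j′)
                               (ℚ.<-asym (spoke-max {ℓ} {ch} j′ on′ (j≢j′ ∘ sym)))
On-unique here (there k p) c c′ on on′ = contradiction on′ (here≢there k p c c′ on)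
On-unique (there k p) here c c′ on on′ = contradiction on (here≢there k p c′ c on′)
On-unique (there k p) (there k′ p′) c c′ on on′ with k Fin.≟ k′
... | no k≢k′  = contradiction (there-min k p c on k≢k′)
                               (ℚ.<-asym (there-min k′ p′ c′ on′ (k≢k′ ∘ sym)))
... | yes refl with r , onᵣ , q≗r ← On-there k p c on | r′ , onᵣ′ , q≗r′ ← On-there k p′ c′ on′
  with refl ← On-unique p p′ c c′ onᵣ
    (On-resp p′ c′ (shrink-injective k (λ i → trans (sym (q≗r′ i)) (q≗r i))) onᵣ′) = refl

On≢corner : ∀ {t} (p : Pos t) c {q} → On p c q → ∀ i → ¬ q ≗ unit i
On≢corner p c on i q≗e with j , i≢j , _ ← avoid i i =
  ℚ.<⇒≢ (On⇒0< p c on j) (sym (trans (q≗e j) (unit-other i≢j)))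

bary-injective : ∀ {t} (x y : Vert t) → bary x ≗ bary y → x ≡ y
bary-injective (inj₁ i) (inj₁ j) eq with i Fin.≟ j
... | yes refl = refl
... | no i≢j   = contradiction (trans (sym (unit-same i)) (trans (eq i) (unit-other (i≢j ∘ sym)))) λ ()
bary-injective (inj₁ i) (inj₂ q) eq = contradiction (sym ∘ eq) (On≢corner q nothing (λ _ → refl) i)
bary-injective (inj₂ p) (inj₁ j) eq = contradiction eq (On≢corner p nothing (λ _ → refl) j)
bary-injective (inj₂ p) (inj₂ q) eq with refl ← On-unique p q nothing nothing (λ _ → refl) eq = refl

-- From barycentric coordinates to the plane

position : ∀ {t} → Vert t → Point
position x = bary x 0F , bary x 1F

toBary : Point → Bary
toBary (a , b) 0F = a
toBary (a , b) 1F = b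
toBary (a , b) 2F = 1ℚ - a - b

shrink-sum : ∀ k x → x 2F ≡ 1ℚ - x 0F - x 1F →
             shrink k x 2F ≡ 1ℚ - shrink k x 0F - shrink k x 1F
shrink-sum 0F x eq rewrite eq =
  solve 2 (λ a b → (con 1ℚ :- a :- b) :+ con ⅓ :* a
                   := con 1ℚ :- con ⅓ :* a :- (b :+ con ⅓ :* a)) refl (x 0F) (x 1F)
shrink-sum 1F x eq rewrite eq =
  solve 2 (λ a b → (con 1ℚ :- a :- b) :+ con ⅓ :* b
                   := con 1ℚ :- (a :+ con ⅓ :* b) :- con ⅓ :* b) refl (x 0F) (x 1F)
shrink-sum 2F x eq rewrite eq =
  solve 2 (λ a b → con ⅓ :* (con 1ℚ :- a :- b)
                   := con 1ℚ :- (a :+ con ⅓ :* (con 1ℚ :- a :- b)) :- (b :+ con ⅓ :* (con 1ℚ :- a :- b)))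
          refl (x 0F) (x 1F)

-- Barycentric coordinates sum to 1, so nothing is lost when `position` drops the third.
bary-sum : ∀ {t} (x : Vert t) → bary x 2F ≡ 1ℚ - bary x 0F - bary x 1F
bary-sum (inj₁ 0F)          = refl
bary-sum (inj₁ 1F)          = refl
bary-sum (inj₁ 2F)          = refl
bary-sum (inj₂ here)        = refl
bary-sum (inj₂ (there k p)) = shrink-sum k (inner p) (bary-sum (inj₂ p))

toBary-position : ∀ {t} (x : Vert t) → toBary (position x) ≗ bary x
toBary-position x 0F = refl
toBary-position x 1F = refl
toBary-position x 2F = sym (bary-sum x)

position-injective : ∀ {t} {x y : Vert t} → position x ≡ position y → x ≡ y
position-injective {x = x} {y} eq = bary-injective x y λ i →
  trans (sym (toBary-position x i)) (trans (cong (λ p → toBary p i) eq) (toBary-position y i))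

toBary-affine : ∀ t {T} (x y : Vert T) →
                toBary (affine t (position x) (position y)) ≗ (λ i → mix t (bary x i) (bary y i))
toBary-affine t x y 0F = refl
toBary-affine t x y 1F = refl
toBary-affine t x y 2F rewrite bary-sum x | bary-sum y =
  solve 5 (λ t a b c d → con 1ℚ :- ((con 1ℚ :- t) :* a :+ t :* c) :- ((con 1ℚ :- t) :* b :+ t :* d)
                         := (con 1ℚ :- t) :* (con 1ℚ :- a :- b) :+ t :* (con 1ℚ :- c :- d))
          refl t (bary x 0F) (bary x 1F) (bary y 0F) (bary y 1F)

mix-0 : ∀ a b → mix 0ℚ a b ≡ a
mix-0 = solve 2 (λ a b → (con 1ℚ :- con 0ℚ) :* a :+ con 0ℚ :* b := a) refl

mix-1 : ∀ a b → mix 1ℚ a b ≡ b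
mix-1 = solve 2 (λ a b → (con 1ℚ :- con 1ℚ) :* a :+ con 1ℚ :* b := b) refl

mix-swap : ∀ t a b → mix t a b ≡ mix (1ℚ - t) b a
mix-swap = solve 3 (λ t a b → (con 1ℚ :- t) :* a :+ t :* b
                              := (con 1ℚ :- (con 1ℚ :- t)) :* b :+ (con 1ℚ :- t) :* a) refl

segment⇒On : ∀ {t} {p : Pos t} {j x y} → Ends p j x y → ∀ {q} s → 0ℚ < s → s < 1ℚ →
             q ≗ (λ i → mix s (bary x i) (bary y i)) → On p (just j) q
segment⇒On (inj₁ (refl , refl)) s 0<s s<1 eq = s , 0<s , s<1 , eq
-- The segment runs towards `p` here, so the parameter is reversed.
segment⇒On {p = p} {j} (inj₂ (refl , refl)) s 0<s s<1 eq =
  1ℚ - s , p<q⇒0<q-p s<1 ,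
  subst (1ℚ - s <_) (ℚ.+-identityʳ 1ℚ) (ℚ.+-monoʳ-< 1ℚ (ℚ.neg-antimono-< 0<s)) ,
  λ i → trans (eq i) (mix-swap s (bary (foot p j) i) (inner p i))

onSegment : ∀ {t} {p : Pos t} {j x y} → Ends p j x y → ∀ q → OnSegment q (position x) (position y) →
            (q ≡ position x) ⊎ (q ≡ position y) ⊎ On p (just j) (toBary q)
onSegment {x = x} {y} ends _ (s , 0≤s , s≤1 , refl) with ℚ.<-cmp 0ℚ s | ℚ.<-cmp s 1ℚ
... | tri≈ _ refl _ | _             = inj₁ (cong₂ _,_ (mix-0 (bary x 0F) (bary y 0F)) (mix-0 (bary x 1F) (bary y 1F)))
... | tri> _ _ s<0  | _             = contradiction (ℚ.<-≤-trans s<0 0≤s) (ℚ.<-irrefl refl)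
... | tri< 0<s _ _  | tri≈ _ refl _ = inj₂ (inj₁ (cong₂ _,_ (mix-1 (bary x 0F) (bary y 0F)) (mix-1 (bary x 1F) (bary y 1F))))
... | tri< 0<s _ _  | tri> _ _ 1<s  = contradiction (ℚ.<-≤-trans 1<s s≤1) (ℚ.<-irrefl refl)
... | tri< 0<s _ _  | tri< s<1 _ _  = inj₂ (inj₂ (segment⇒On ends s 0<s s<1 (toBary-affine s x y)))

-- Planarity of stacked triangulations

pullback : {V W : Set} → (W → V) → SignifiedGraph V → SignifiedGraph W
pullback f G = record
  { sign      = λ x y → sign G (f x) (f y)
  ; symmetric = λ x y → SignifiedGraph.symmetric G (f x) (f y)
  ; loopless  = λ x → SignifiedGraph.loopless G (f x)
  }

-- `On-unique` and `On≢corner` keep inner vertices, open edges and corners apart, so distinct edges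
-- meet only in their ends.
stacked-planar : ∀ {n t} {f : Fin n → Vert t} → Injective _≡_ _≡_ f →
                 Planar (underlying (pullback f (stacked t)))
stacked-planar {n} {t} {f} f-injective = record
  { pos           = position ∘ f
  ; bends         = λ _ _ → []
  ; pos-injective = f-injective ∘ position-injective
  ; edge-arc      = λ u v (u<v , _) eq → Fin.<⇒≢ u<v (f-injective (position-injective eq))
  ; edge-vertex   = edge-vertex
  ; edge-edge     = edge-edge
  }
  where
  G : SimpleGraph (Fin n)
  G = underlying (pullback f (stacked t))

  edge-vertex : ∀ u v w → Edge G u v → OnSegment (position (f w)) (position (f u)) (position (f v)) →
                w ≡ u ⊎ w ≡ v
  edge-vertex u v w (_ , _ , e) on with p , j , ends ← edge⇒ends (f u) (f v) e with onSegment ends _ on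
  ... | inj₁ w≡u        = inj₁ (f-injective (position-injective w≡u))
  ... | inj₂ (inj₁ w≡v) = inj₂ (f-injective (position-injective w≡v))
  ... | inj₂ (inj₂ onʷ) with f w | toBary-position (f w)
  ... | inj₁ i | eq = contradiction eq (On≢corner p (just j) onʷ i)
  ... | inj₂ r | eq with () ← On-unique p r (just j) nothing onʷ eq

  same-ends : ∀ {p j u v u′ v′} → u Fin.< v → u′ Fin.< v′ → Ends p j (f u) (f v) → Ends p j (f u′) (f v′) →
              (u , v) ≡ (u′ , v′)
  same-ends _ _ (inj₁ (a , b)) (inj₁ (a′ , b′)) =
    cong₂ _,_ (f-injective (trans a (sym a′))) (f-injective (trans b (sym b′)))
  same-ends _ _ (inj₂ (a , b)) (inj₂ (a′ , b′)) =
    cong₂ _,_ (f-injective (trans b (sym b′))) (f-injective (trans a (sym a′)))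
  same-ends u<v u′<v′ (inj₁ (a , b)) (inj₂ (a′ , b′))
    with refl ← f-injective (trans a (sym a′)) | refl ← f-injective (trans b (sym b′)) =
    contradiction u<v (Fin.<-asym u′<v′)
  same-ends u<v u′<v′ (inj₂ (a , b)) (inj₁ (a′ , b′))
    with refl ← f-injective (trans a (sym a′)) | refl ← f-injective (trans b (sym b′)) =
    contradiction u<v (Fin.<-asym u′<v′)

  edge-edge : ∀ u v u′ v′ → Edge G u v → Edge G u′ v′ → (u , v) ≢ (u′ , v′) →
              ∀ q → OnSegment q (position (f u)) (position (f v)) →
              OnSegment q (position (f u′)) (position (f v′)) → ∃[ w ] q ≡ position (f w)
  edge-edge u v u′ v′ (u<v , _ , e) (u′<v′ , _ , e′) ≢ q on on′
    with p , j , ends ← edge⇒ends (f u) (f v) e | p′ , j′ , ends′ ← edge⇒ends (f u′) (f v′) e′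
    with onSegment ends q on | onSegment ends′ q on′
  ... | inj₁ eq          | _                 = u , eq
  ... | inj₂ (inj₁ eq)   | _                 = v , eq
  ... | inj₂ (inj₂ _)    | inj₁ eq           = u′ , eq
  ... | inj₂ (inj₂ _)    | inj₂ (inj₁ eq)    = v′ , eq
  ... | inj₂ (inj₂ open₁) | inj₂ (inj₂ open₂)
    with refl ← On-unique p p′ (just j) (just j′) open₁ open₂ =
    contradiction (same-ends u<v u′<v′ ends ends′) ≢

-- Planarity is defined for graphs on `Fin n`, so the vertices have to be numbered.
Fin↔Pos : ∀ t → ∃[ n ] (Fin n ↔ Pos t)
Fin↔Pos leaf        = 0 , mk↔ₛ′ (λ ()) (λ ()) (λ ()) (λ ())
Fin↔Pos (node ℓ ch) = _ ,
  ↔-trans Fin.+↔⊎ (↔-trans (Fin.1↔⊤ ⊎-↔ ↔-trans Fin.+↔⊎ (sub 0F ⊎-↔ ↔-trans Fin.+↔⊎ (sub 1F ⊎-↔ sub 2F)))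
    (mk↔ₛ′ to from to∘from from∘to))
  where
  sub = λ k → proj₂ (Fin↔Pos (ch k))

  to : ⊤ ⊎ Pos (ch 0F) ⊎ Pos (ch 1F) ⊎ Pos (ch 2F) → Pos (node ℓ ch)
  to (inj₁ _)               = here
  to (inj₂ (inj₁ p))        = there 0F p
  to (inj₂ (inj₂ (inj₁ p))) = there 1F p
  to (inj₂ (inj₂ (inj₂ p))) = there 2F p

  from : Pos (node ℓ ch) → ⊤ ⊎ Pos (ch 0F) ⊎ Pos (ch 1F) ⊎ Pos (ch 2F)
  from here         = inj₁ tt
  from (there 0F p) = inj₂ (inj₁ p)
  from (there 1F p) = inj₂ (inj₂ (inj₁ p))
  from (there 2F p) = inj₂ (inj₂ (inj₂ p))

  to∘from : ∀ p → to (from p) ≡ p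
  to∘from here         = refl
  to∘from (there 0F _) = refl
  to∘from (there 1F _) = refl
  to∘from (there 2F _) = refl

  from∘to : ∀ x → from (to x) ≡ x
  from∘to (inj₁ _)               = refl
  from∘to (inj₂ (inj₁ _))        = refl
  from∘to (inj₂ (inj₂ (inj₁ _))) = refl
  from∘to (inj₂ (inj₂ (inj₂ _))) = refl

-- Homomorphisms from stacked triangulations

infix 9 _[_≔_]

_[_≔_] : {W : Set} → (Fin 3 → W) → Fin 3 → W → Fin 3 → W
(c [ k ≔ d ]) i = if does (i Fin.≟ k) then d else c i

-- The inner vertices of t can be mapped to H if its corners are mapped by c.
Fills : {W : Set} → SignifiedGraph W → Tree → (Fin 3 → W) → Set
Fills H leaf        c = ⊤
Fills H (node ℓ ch) c = ∃[ d ] (∀ i → sign H (c i) d ≡ just (ℓ i)) × (∀ k → Fills H (ch k) (c [ k ≔ d ]))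

-- Unfolds a homomorphism into nested choices that can be read one triangle at a time; at each level
-- the inserted vertex becomes corner `k`.
fills : ∀ {W} (H : SignifiedGraph W) t c (g : Pos t → W) →
        (∀ i p s → cornerSign i p ≡ just s → sign H (c i) (g p) ≡ just s) →
        (∀ p q s → innerSign p q ≡ just s → sign H (g p) (g q) ≡ just s) →
        Fills H t c
fills H leaf        c g corner inn = tt
fills H (node ℓ ch) c g corner inn = g here , (λ i → corner i here _ refl) , λ k →
  fills H (ch k) (c [ k ≔ g here ]) (g ∘ there k) (corner′ k)
    (λ p q s e → inn (there k p) (there k q) s (trans (same k p q) e))
  where
  same : ∀ k p q → innerSign {node ℓ ch} (there k p) (there k q) ≡ innerSign p q
  same k p q with k Fin.≟ k
  ... | yes refl = refl
  ... | no k≢k   = contradiction refl k≢k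

  corner′ : ∀ k i p s → cornerSign i p ≡ just s → sign H ((c [ k ≔ g here ]) i) (g (there k p)) ≡ just s
  corner′ k i p s e with i Fin.≟ k in i≟k
  ... | yes refl = inn here (there k p) s e
  ... | no _     = corner i (there k p) s (trans (cong (λ d → if does d then nothing else cornerSign i p) i≟k) e)

planar⇒fills : ∀ {W} (H : SignifiedGraph W) →
  ((n : ℕ) (G : SignifiedGraph (Fin n)) → Planar (underlying G) → G ⟶ H) →
  ∀ t → ∃[ c ] Fills H t c
planar⇒fills H universal t with n , pos ← Fin↔Pos t = h ∘ inj₁ ,
  fills H t (h ∘ inj₁) (h ∘ inj₂) (λ i p → preserves (inj₁ i) (inj₂ p)) (λ p q → preserves (inj₂ p) (inj₂ q))
  where
  vert : Fin (3 ℕ.+ n) ↔ Vert t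
  vert = ↔-trans Fin.+↔⊎ (↔-refl ⊎-↔ pos)
  open Inverse vert

  hom : pullback to (stacked t) ⟶ H
  hom = universal (3 ℕ.+ n) (pullback to (stacked t)) (stacked-planar {t = t} {f = to} (λ {x} {y} → injective {x} {y}))
    where
    injective : Injective _≡_ _≡_ to
    injective {x} {y} e = trans (sym (strictlyInverseʳ x)) (trans (cong from e) (strictlyInverseʳ y))

  h = proj₁ hom ∘ from

  preserves : ∀ x y s → sign (stacked t) x y ≡ just s → sign H (h x) (h y) ≡ just s
  preserves x y s e = proj₂ hom (from x) (from y) s
    (trans (cong₂ (sign (stacked t)) (strictlyInverseˡ x) (strictlyInverseˡ y)) e)

-- Fans and alternating paths

-- Inserts a path of common neighbours of corners 0 and 1, and a copy of t next to every edge from these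
-- corners to the path; the first sign is that of the edge to corner 1,
-- the second that of the edge to the preceding vertex of the path.
fan : Tree → List (Sign × Sign) → Tree
fan t []             = leaf
fan t ((a , b) ∷ ls) = node (lookup (Sign.+ ∷ a ∷ b ∷ [])) (lookup (t ∷ t ∷ fan t ls ∷ []))

-- Two blocks of five, with signs + and - towards corner 1. Inside a block the path edges alternate
-- +, -, +, -; the leading second sign joins the block to the vertex before it.
word : List (Sign × Sign)
word = (Sign.+ , Sign.+) ∷ (Sign.+ , Sign.+) ∷ (Sign.+ , Sign.-) ∷ (Sign.+ , Sign.+) ∷ (Sign.+ , Sign.-) ∷
       (Sign.- , Sign.+) ∷ (Sign.- , Sign.+) ∷ (Sign.- , Sign.-) ∷ (Sign.- , Sign.+) ∷ (Sign.- , Sign.-) ∷ []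

module _ {W : Set} (H : SignifiedGraph W) where

  -- The third corner, which varies along the path, is left unspecified.
  Filled : Tree → W → W → Set
  Filled t v u = ∃[ c ] c 0F ≡ v × c 1F ≡ u × Fills H t c

  Rib : Tree → W → W → Sign → W → Set
  Rib t v u a d = sign H v d ≡ just Sign.+ × sign H u d ≡ just a × Filled t v d × Filled t d u

  Run : (Sign → W → Set) → W → List (Sign × Sign) → Set
  Run P w []             = ⊤
  Run P w ((a , b) ∷ ls) = ∃[ d ] sign H w d ≡ just b × P a d × Run P d ls

  fan⇒run : ∀ t ls c → Fills H (fan t ls) c → Run (Rib t (c 0F) (c 1F)) (c 2F) ls
  fan⇒run t []             c _                 = tt
  fan⇒run t ((a , b) ∷ ls) c (d , signs , subs) =
    d , signs 2F ,
    (signs 0F , signs 1F , (c [ 1F ≔ d ] , refl , refl , subs 1F) , (c [ 0F ≔ d ] , refl , refl , subs 0F)) ,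
    fan⇒run t ls (c [ 2F ≔ d ]) (subs 2F)

  sign-≢ : ∀ {x y z s} → sign H x y ≡ just s → sign H x z ≡ just (opposite s) → y ≢ z
  sign-≢ {s = s} e e′ refl = Sign.s≢opposite[s] s (Maybe.just-injective (trans (sym e) e′))

  adjacent-≢ : ∀ {x y s} → sign H x y ≡ just s → x ≢ y
  adjacent-≢ {x} e refl with () ← trans (sym e) (SignifiedGraph.loopless H x)

  flip : ∀ {x y s} → sign H x y ≡ just s → sign H y x ≡ just s
  flip = trans (SignifiedGraph.symmetric H _ _)

  Four : (W → Set) → Set
  Four P = Σ[ r ∈ (Fin 4 → W) ] Injective _≡_ _≡_ r × (∀ i → P (r i))

  four : ∀ {P : W → Set} {a b c d} → a ≢ b → a ≢ c → a ≢ d → b ≢ c → b ≢ d → c ≢ d →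
         P a → P b → P c → P d → Four P
  four {P} {a} {b} {c} {d} a≢b a≢c a≢d b≢c b≢d c≢d pa pb pc pd =
    lookup abcd , (λ {i} {j} → lookup-injective unique i j) , λ { 0F → pa ; 1F → pb ; 2F → pc ; 3F → pd }
    where
    abcd = a ∷ b ∷ c ∷ d ∷ []
    unique : Unique abcd
    unique = (a≢b ∷ a≢c ∷ a≢d ∷ []) ∷ (b≢c ∷ b≢d ∷ []) ∷ (c≢d ∷ []) ∷ [] ∷ []

  -- If the first and the fourth vertex coincide then the second and the fifth do not, since they
  -- are joined to that vertex by edges of opposite signs.
  alternating⇒four : DecidableEquality W → ∀ {P x₁ x₂ x₃ x₄ x₅} →
    sign H x₁ x₂ ≡ just Sign.+ → sign H x₂ x₃ ≡ just Sign.- →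
    sign H x₃ x₄ ≡ just Sign.+ → sign H x₄ x₅ ≡ just Sign.- →
    P x₁ → P x₂ → P x₃ → P x₄ → P x₅ → Four P
  alternating⇒four _≟_ {P} {x₁} {x₂} {x₃} {x₄} {x₅} e₁ e₂ e₃ e₄ p₁ p₂ p₃ p₄ p₅ with x₁ ≟ x₄
  ... | no x₁≢x₄ = four (adjacent-≢ e₁) (sign-≢ (flip e₁) e₂) x₁≢x₄ (adjacent-≢ e₂) (sign-≢ (flip e₂) e₃)
                        (adjacent-≢ e₃) p₁ p₂ p₃ p₄
  ... | yes refl = four (adjacent-≢ e₂) (sign-≢ (flip e₂) e₃) (sign-≢ e₁ e₄) (adjacent-≢ e₃)
                        (sign-≢ (flip e₃) e₄) (adjacent-≢ e₄) p₂ p₃ p₄ p₅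

  word⇒four : DecidableEquality W → ∀ {P w} → Run P w word → ∀ a → Four (P a)
  word⇒four _≟_
    ( x₁ , _ , p₁ , x₂ , e₁ , p₂ , x₃ , e₂ , p₃ , x₄ , e₃ , p₄ , x₅ , e₄ , p₅
    , y₁ , _ , q₁ , y₂ , f₁ , q₂ , y₃ , f₂ , q₃ , y₄ , f₃ , q₄ , y₅ , f₄ , q₅ , _ ) =
    λ { Sign.+ → alternating⇒four _≟_ e₁ e₂ e₃ e₄ p₁ p₂ p₃ p₄ p₅
      ; Sign.- → alternating⇒four _≟_ f₁ f₂ f₃ f₄ q₁ q₂ q₃ q₄ q₅ }

opaque
  -- Pigeonhole: if `y` were missed, `punchOut` would inject `Fin (suc n)` into `Fin n`.
  injective⇒surjective : ∀ {n} {f : Fin n → Fin n} → Injective _≡_ _≡_ f → ∀ y → ∃[ x ] f x ≡ y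
  injective⇒surjective {suc n} {f} inj y with Fin.any? (λ x → f x Fin.≟ y)
  ... | yes hit = hit
  ... | no miss = contradiction
    (Fin.injective⇒≤ {f = λ x → punchOut (λ e → miss (x , sym e))}
      (λ {i} {j} e → inj (Fin.punchOut-injective (λ e → miss (i , sym e)) (λ e → miss (j , sym e)) e)))
    ℕ.1+n≰n

-- Common neighbours in anti-twinned graphs

-- Opaque, since the trees are too large to be unfolded by the type checker.
opaque
  gadget : ℕ → Tree
  gadget zero    = leaf
  gadget (suc k) = fan (gadget k) word

  gadget-suc : ∀ k → gadget (suc k) ≡ fan (gadget k) word
  gadget-suc k = refl

opposite-*ʳ : ∀ s t → s Sign.* opposite t ≡ opposite (s Sign.* t)
opposite-*ʳ Sign.+ t = refl
opposite-*ʳ Sign.- t = refl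

opposite-*ˡ : ∀ s t → opposite s Sign.* t ≡ opposite (s Sign.* t)
opposite-*ˡ Sign.- t = sym (Sign.opposite-involutive t)
opposite-*ˡ Sign.+ t = refl

opposite-*-opposite : ∀ s t → opposite s Sign.* opposite t ≡ s Sign.* t
opposite-*-opposite s t = trans (opposite-*ˡ s _)
  (trans (cong opposite (opposite-*ʳ s t)) (Sign.opposite-involutive (s Sign.* t)))

-- `twinSign i k` multiplies by -1 to the power i + k, so the contributions of `k` cancel.
twinSign-* : ∀ i j k s t → twinSign i k s Sign.* twinSign j k t ≡ twinSign i j (s Sign.* t)
twinSign-* 0F 0F 0F s t = refl
twinSign-* 0F 0F 1F s t = opposite-*-opposite s t
twinSign-* 0F 1F 0F s t = opposite-*ʳ s t
twinSign-* 0F 1F 1F s t = opposite-*ˡ s t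
twinSign-* 1F 0F 0F s t = opposite-*ˡ s t
twinSign-* 1F 0F 1F s t = opposite-*ʳ s t
twinSign-* 1F 1F 0F s t = opposite-*-opposite s t
twinSign-* 1F 1F 1F s t = refl

twinSign-involutive : ∀ i j s → twinSign i j (twinSign i j s) ≡ s
twinSign-involutive i j s with i Fin.≟ j
... | yes _ = refl
... | no _  = Sign.opposite-involutive s

twinSign-injective : ∀ i j k s → twinSign i j s ≡ twinSign i k s → j ≡ k
twinSign-injective i  0F 0F s eq = refl
twinSign-injective i  1F 1F s eq = refl
twinSign-injective 0F 0F 1F s eq = contradiction eq (Sign.s≢opposite[s] s)
twinSign-injective 0F 1F 0F s eq = contradiction (sym eq) (Sign.s≢opposite[s] s)
twinSign-injective 1F 0F 1F s eq = contradiction (sym eq) (Sign.s≢opposite[s] s)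
twinSign-injective 1F 1F 0F s eq = contradiction eq (Sign.s≢opposite[s] s)

-- `nothing` acts as the zero entry of a conference matrix.
_⊙_ : Maybe Sign → Maybe Sign → Maybe Sign
_⊙_ = zipWith Sign._*_

⊙-comm : ∀ m n → m ⊙ n ≡ n ⊙ m
⊙-comm nothing  nothing  = refl
⊙-comm nothing  (just _) = refl
⊙-comm (just _) nothing  = refl
⊙-comm (just s) (just t) = cong just (Sign.*-comm s t)

twin-⊙ : ∀ i j k m n → Maybe.map (twinSign i k) m ⊙ Maybe.map (twinSign j k) n ≡ Maybe.map (twinSign i j) (m ⊙ n)
twin-⊙ i j k nothing  _        = refl
twin-⊙ i j k (just _) nothing  = refl
twin-⊙ i j k (just s) (just t) = cong just (twinSign-* i j k s t)

map-twin-involutive : ∀ i j m → Maybe.map (twinSign i j) (Maybe.map (twinSign i j) m) ≡ m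
map-twin-involutive i j nothing  = refl
map-twin-involutive i j (just s) = cong just (twinSign-involutive i j s)

-- If n = 10 and the diagonal of A is nothing, the rows of x and y are orthogonal: the four positive and
-- four negative products account for all indices but x and y.
Balanced : ∀ {n} → (Fin n → Fin n → Maybe Sign) → Fin n → Fin n → Set
Balanced {n} A x y = ∀ s → Σ[ z ∈ (Fin 4 → Fin n) ] Injective _≡_ _≡_ z × (∀ i → A x (z i) ⊙ A y (z i) ≡ just s)

Balanced-sym : ∀ {n} (A : Fin n → Fin n → Maybe Sign) {x y} → Balanced A x y → Balanced A y x
Balanced-sym A {x} {y} b s = map₂ (λ {z} → map₂ (λ e i → trans (⊙-comm (A y (z i)) _) (e i))) (b s)

-- Names for ten vertices: `nothing` for v, `just nothing` for u, the rest for the eight ribs, by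
-- their sign towards u.
Index : Set
Index = Maybe (Maybe (Sign × Fin 4))

rank : Index → Fin 10
rank nothing                      = 0F
rank (just nothing)               = 1F
rank (just (just (Sign.+ , i)))   = suc (suc (i Fin.↑ˡ 4))
rank (just (just (Sign.- , i)))   = suc (suc (4 Fin.↑ʳ i))

rib : Fin 8 → Sign × Fin 4
rib = [ Sign.+ ,_ , Sign.- ,_ ]′ ∘ Fin.splitAt 4

index : Fin 10 → Index
index 0F            = nothing
index 1F            = just nothing
index (suc (suc i)) = just (just (rib i))

rank-index : ∀ i → rank (index i) ≡ i
rank-index = from-yes (Fin.all? λ i → rank (index i) Fin.≟ i)

index-injective : Injective _≡_ _≡_ index
index-injective {i} {j} e = trans (sym (rank-index i)) (trans (cong rank e) (rank-index j))

module _ (H : SignifiedGraph (Fin 10)) where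

  private
    W = Fin 10 × Fin 2
    _≟_ = ≡-dec (Fin._≟_ {10}) (Fin._≟_ {2})

  AT-≢ : ∀ (x y : W) {s} → sign (AT H) x y ≡ just s → proj₁ x ≢ proj₁ y
  AT-≢ (x , i) (_ , j) e refl with () ← trans (sym e) (cong (Maybe.map (twinSign i j)) (SignifiedGraph.loopless H x))

  -- The edges from `x` to two twins have opposite signs, so a prescribed sign selects at most one
  -- of them.
  AT-unique : ∀ (x y z : W) {s} → sign (AT H) x y ≡ just s → sign (AT H) x z ≡ just s → proj₁ y ≡ proj₁ z → y ≡ z
  AT-unique (x , i) (y , j) (_ , k) e e′ refl with sign H x y
  ... | just s = cong (y ,_) (twinSign-injective i j k s (Maybe.just-injective (trans e (sym e′))))

  Ribs : ℕ → W → W → Set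
  Ribs k v u = ∀ a → Four (AT H) (Rib (AT H) (gadget k) v u a)

  ribs : ∀ {k v u} → Filled (AT H) (gadget (suc k)) v u → Ribs k v u
  ribs {k} (c , refl , refl , f) =
    word⇒four (AT H) _≟_ {Rib (AT H) (gadget k) (c 0F) (c 1F)} {c 2F}
      (fan⇒run (AT H) (gadget k) word c (subst (λ t → Fills (AT H) t c) (gadget-suc k) f))

  module Frame {k v u s} (v~u : sign (AT H) v u ≡ just s) (r : Ribs k v u) where

    label : Index → W
    label nothing               = v
    label (just nothing)        = u
    label (just (just (a , i))) = proj₁ (r a) i

    v~r : ∀ a i → sign (AT H) v (proj₁ (r a) i) ≡ just Sign.+
    v~r a i = proj₁ (proj₂ (proj₂ (r a)) i)

    u~r : ∀ a i → sign (AT H) u (proj₁ (r a) i) ≡ just a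
    u~r a i = proj₁ (proj₂ (proj₂ (proj₂ (r a)) i))

    -- Adjacent vertices lie in different twin pairs. Two ribs in one pair coincide, both being
    -- positive neighbours of `v`; their sign towards `u` then identifies the class.
    label-injective : Injective _≡_ _≡_ (proj₁ ∘ label)
    label-injective {nothing}               {nothing}               e = refl
    label-injective {nothing}               {just nothing}          e = contradiction e (AT-≢ v u v~u)
    label-injective {nothing}               {just (just (a , i))}   e = contradiction e (AT-≢ v (proj₁ (r a) i) (v~r a i))
    label-injective {just nothing}          {nothing}               e = contradiction (sym e) (AT-≢ v u v~u)
    label-injective {just nothing}          {just nothing}          e = refl
    label-injective {just nothing}          {just (just (a , i))}   e = contradiction e (AT-≢ u (proj₁ (r a) i) (u~r a i))
    label-injective {just (just (a , i))}   {nothing}               e = contradiction (sym e) (AT-≢ v (proj₁ (r a) i) (v~r a i))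
    label-injective {just (just (a , i))}   {just nothing}          e = contradiction (sym e) (AT-≢ u (proj₁ (r a) i) (u~r a i))
    label-injective {just (just (a , i))}   {just (just (b , j))}   e
      with same ← AT-unique v (proj₁ (r a) i) (proj₁ (r b) j) (v~r a i) (v~r b j) e
      with refl ← Maybe.just-injective (trans (sym (u~r a i)) (trans (cong (sign (AT H) u) same) (u~r b j))) =
      cong (λ l → just (just (a , l))) (proj₁ (proj₂ (r a)) same)

    frame : Fin 10 → W
    frame = label ∘ index

    frame-injective : Injective _≡_ _≡_ (proj₁ ∘ frame)
    frame-injective = index-injective ∘ label-injective

    frame-surjective : ∀ x → ∃[ i ] proj₁ (frame i) ≡ x
    frame-surjective = injective⇒surjective frame-injective

    cover : ∀ x → x ≢ proj₁ v → x ≢ proj₁ u → ∃[ a ] ∃[ i ] proj₁ (proj₁ (r a) i) ≡ x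
    cover x x≢v x≢u with i , refl ← frame-surjective x with index i
    ... | nothing             = contradiction refl x≢v
    ... | just nothing        = contradiction refl x≢u
    ... | just (just (a , i)) = a , i , refl

    balanced : Balanced (sign H) (proj₁ v) (proj₁ u)
    balanced s = proj₁ ∘ rₛ , (λ {i} {j} e → proj₁ (proj₂ (r a)) (AT-unique v (rₛ i) (rₛ j) (v~r a i) (v~r a j) e)) , λ i → begin
      m i ⊙ n i                           ≡⟨ map-twin-involutive (proj₂ v) (proj₂ u) _ ⟨
      Maybe.map τ (Maybe.map τ (m i ⊙ n i)) ≡⟨ cong (Maybe.map τ) (twin-⊙ (proj₂ v) (proj₂ u) (proj₂ (rₛ i))
                                                                              (m i) (n i)) ⟨
      Maybe.map τ (sign (AT H) v (rₛ i) ⊙ sign (AT H) u (rₛ i)) ≡⟨ cong (Maybe.map τ) (cong₂ _⊙_ (v~r a i) (u~r a i)) ⟩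
      just (τ (τ s))                      ≡⟨ cong just (twinSign-involutive (proj₂ v) (proj₂ u) s) ⟩
      just s                              ∎
      where
      open ≡-Reasoning
      τ = twinSign (proj₂ v) (proj₂ u)
      -- In the class `a` the products of the two rows of `AT H` equal `a`. Passing to `H`
      -- multiplies them by the sign that `τ` stands for, so `τ s` is the class with product `s`.
      a = τ s
      rₛ = proj₁ (r a)
      m n : Fin 4 → Maybe Sign
      m i = sign H (proj₁ v) (proj₁ (rₛ i))
      n i = sign H (proj₁ u) (proj₁ (rₛ i))

  -- A record, so that k can be inferred.
  record Pair (k : ℕ) (v u : W) : Set where
    constructor pair
    field
      {edgeSign} : Sign
      adjacent   : sign (AT H) v u ≡ just edgeSign
      filled     : Filled (AT H) (gadget k) v u

  Linked : Fin 10 → Fin 10 → Set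
  Linked x y = (∃[ s ] sign H x y ≡ just s) × Balanced (sign H) x y

  Linked-sym : ∀ {x y} → Linked x y → Linked y x
  Linked-sym {x} {y} ((s , e) , b) =
    (s , trans (SignifiedGraph.symmetric H y x) e) , Balanced-sym (sign H) b

  linked : ∀ {k v u} → Pair (suc k) v u → Linked (proj₁ v) (proj₁ u)
  linked {k} {v} {u} (pair e f) = joined , Frame.balanced {k} e (ribs {k} f)
    where
    joined : ∃[ s ] sign H (proj₁ v) (proj₁ u) ≡ just s
    joined with sign H (proj₁ v) (proj₁ u)
    ... | just s = s , refl

  -- The ribs reach every remaining vertex of `H`, and each carries gadgets of one level less on its
  -- edges to both ends.
  split : ∀ {k v u} → Pair (suc k) v u → ∀ x → x ≢ proj₁ v → x ≢ proj₁ u →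
          ∃[ d ] proj₁ d ≡ x × Pair k v d × Pair k d u
  split {k} {v} {u} (pair e f) x x≢v x≢u
    with r ← ribs {k} f
    with a , i , eq ← Frame.cover {k} e r x x≢v x≢u
    with v~d , u~d , vd , du ← proj₂ (proj₂ (r a)) i =
    _ , eq , pair v~d vd , pair (trans (SignifiedGraph.symmetric (AT H) (proj₁ (r a) i) u) u~d) du

  -- One level of gadgets moves the second end to `y`, the next yields the balance.
  linkedˡ : ∀ {k v u} → Pair (suc (suc k)) v u → ∀ y → y ≢ proj₁ v → Linked (proj₁ v) y
  linkedˡ {k} {v} {u} p y y≢v with y Fin.≟ proj₁ u
  ... | yes refl = linked p
  ... | no y≢u with d , refl , vd , _ ← split p y y≢v y≢u = linked vd

  -- Three levels suffice: one to move an end to `x`, one to move the other end to `y`, one for the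
  -- balance.
  allLinked : ∀ {k v u} → Pair (suc (suc (suc k))) v u → ∀ x y → x ≢ y → Linked x y
  allLinked {k} {v} {u} p x y x≢y with x Fin.≟ proj₁ v | x Fin.≟ proj₁ u
  ... | yes refl | _      = linkedˡ p y (x≢y ∘ sym)
  ... | no x≢v   | no x≢u with d , refl , _ , du ← split p x x≢v x≢u = linkedˡ du y (x≢y ∘ sym)
  ... | no x≢v   | yes refl with y Fin.≟ proj₁ v
  ... | yes refl = Linked-sym (linked p)
  ... | no y≢v with d , refl , _ , du ← split p y y≢v (x≢y ∘ sym) = Linked-sym (linked du)

-- Symmetric conference matrices of order 10

_≟ₘ_ : DecidableEquality (Maybe Sign)
_≟ₘ_ = Maybe.≡-dec Sign._≟_

does⇒ : {P : Set} (d : Dec P) → does d ≡ true → P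
does⇒ (yes p) _ = p

length-filter-map : {A B : Set} {P : B → Set} (P? : Decidable P) (f : A → B) (xs : List A) →
                    length (filter P? (List.map f xs)) ≡ length (filter (P? ∘ f) xs)
length-filter-map P? f []       = refl
length-filter-map P? f (x ∷ xs) with does (P? (f x))
... | true  = cong suc (length-filter-map P? f xs)
... | false = length-filter-map P? f xs

injective⇒≤length : ∀ {A : Set} {k} {z : Fin k → A} {xs} → Injective _≡_ _≡_ z → (∀ i → z i ∈ xs) → k ℕ.≤ length xs
injective⇒≤length {xs = xs} inj z∈ = Fin.injective⇒≤ {f = Any.index ∘ z∈} λ {i} {j} e →
  inj (trans (lookup-index (z∈ i)) (trans (cong (List.lookup xs) e) (sym (lookup-index (z∈ j)))))

≤length-filter : ∀ {A : Set} {P : A → Set} (P? : Decidable P) {k n} (f : Fin n → A) {z : Fin k → Fin n} →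
                 Injective _≡_ _≡_ z → (∀ i → P (f (z i))) → k ℕ.≤ length (filter P? (tabulate f))
≤length-filter P? {k} f {z} inj hits = subst (k ℕ.≤_)
  (trans (sym (length-filter-map P? f (allFin _))) (cong (length ∘ filter P?) (List.map-tabulate (λ i → i) f)))
  (injective⇒≤length inj (λ i → ∈-filter⁺ (P? ∘ f) (∈-allFin (z i)) (hits i)))

zipWith-tabulate : ∀ {A B C : Set} (h : A → B → C) {n} (f : Fin n → A) (g : Fin n → B) →
                   List.zipWith h (tabulate f) (tabulate g) ≡ tabulate (λ i → h (f i) (g i))
zipWith-tabulate h {zero}  f g = refl
zipWith-tabulate h {suc n} f g = cong (h (f 0F) (g 0F) ∷_) (zipWith-tabulate h (f ∘ suc) (g ∘ suc))

Row : Set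
Row = List (Maybe Sign)

-- Two distinct rows of order 10 have at most eight nonzero products, so these lower bounds force
-- exactly four of each sign.
Orthogonal : Row → Row → Set
Orthogonal x y = 4 ℕ.≤ tally Sign.+ × 4 ℕ.≤ tally Sign.-
  where
  tally : Sign → ℕ
  tally s = length (filter (_≟ₘ just s) (List.zipWith _⊙_ x y))

orthogonal? : ∀ x y → Dec (Orthogonal x y)
orthogonal? x y = _ ℕ.≤? _ ×-dec _ ℕ.≤? _

balanced⇒orthogonal : ∀ {n} (A : Fin n → Fin n → Maybe Sign) {i j} → Balanced A i j →
                      Orthogonal (tabulate (A i)) (tabulate (A j))
balanced⇒orthogonal A {i} {j} b
  rewrite zipWith-tabulate _⊙_ (A i) (A j) =
  ≤length-filter (_≟ₘ just Sign.+) (λ k → A i k ⊙ A j k) (proj₁ (proj₂ (b Sign.+))) (proj₂ (proj₂ (b Sign.+))) ,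
  ≤length-filter (_≟ₘ just Sign.-) (λ k → A i k ⊙ A j k) (proj₁ (proj₂ (b Sign.-))) (proj₂ (proj₂ (b Sign.-)))

-- Exhaustive search

everySigns : ℕ → (List Sign → Bool) → Bool
everySigns zero    f = f []
everySigns (suc n) f = everySigns n (f ∘ (Sign.+ ∷_)) ∧ everySigns n (f ∘ (Sign.- ∷_))

∧-true : ∀ {a b} → a ∧ b ≡ true → a ≡ true × b ≡ true
∧-true {true} {true} _ = refl , refl

everySigns-sound : ∀ {n} f → everySigns n f ≡ true → (v : Fin n → Sign) → f (tabulate v) ≡ true
everySigns-sound {zero}  f e v = e
everySigns-sound {suc n} f e v with v 0F | ∧-true {everySigns n (f ∘ (Sign.+ ∷_))} e
... | Sign.+ | e₊ , _  = everySigns-sound (f ∘ (Sign.+ ∷_)) e₊ (v ∘ suc)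
... | Sign.- | _  , e₋ = everySigns-sound (f ∘ (Sign.- ∷_)) e₋ (v ∘ suc)

module Search (accept : List Row → Bool) where

  -- rows are the rows of a symmetric matrix found so far, cols the known initial parts of the others.
  search : ℕ → List Row → List Row → Bool
  search zero    rows _          = accept rows
  search (suc r) rows []         = true
  search (suc r) rows (c ∷ cols) = everySigns r λ v →
    let row = c ++ nothing ∷ List.map just v in
    if does (All.all? (orthogonal? row) rows)
    then search r (rows ∷ʳ row) (List.zipWith (λ c s → c ∷ʳ just s) cols v)
    -- A branch whose new row violates orthogonality is pruned and counts as passed.
    else true

  -- `B` is the part of the matrix not yet reached and `c` holds the initial parts already forced by
  -- symmetry. The actual first row of `B` is among the choices tried, and orthogonality saves it
  -- from being pruned.
  search-sound : ∀ r rows (c : Fin r → Row) (B : Fin r → Fin r → Maybe Sign) (full : Fin r → Row) →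
    (∀ i j → B i j ≡ B j i) → (∀ i → B i i ≡ nothing) → (∀ i j → i ≢ j → ∃[ s ] B i j ≡ just s) →
    (∀ i → full i ≡ c i ++ tabulate (B i)) →
    (∀ i → All (Orthogonal (full i)) rows) → (∀ i j → i ≢ j → Orthogonal (full i) (full j)) →
    search r rows (tabulate c) ≡ true → accept (rows ++ tabulate full) ≡ true
  search-sound zero rows c B full B-sym B-irr B-just full≡ orth orth′ e =
    trans (cong accept (List.++-identityʳ rows)) e
  search-sound (suc r) rows c B full B-sym B-irr B-just full≡ orth orth′ e =
    trans (cong accept (sym (List.++-assoc rows (full 0F ∷ []) (tabulate (full ∘ suc)))))
      (search-sound r (rows ∷ʳ full 0F) (λ i → c (suc i) ∷ʳ just (v i)) (λ i j → B (suc i) (suc j)) (full ∘ suc)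
        (λ i j → B-sym (suc i) (suc j)) (λ i → B-irr (suc i))
        (λ i j i≢j → B-just (suc i) (suc j) (i≢j ∘ Fin.suc-injective))
        full′≡ (λ i → All.++⁺ (orth (suc i)) (orth′ (suc i) 0F (λ ()) ∷ []))
        (λ i j i≢j → orth′ (suc i) (suc j) (i≢j ∘ Fin.suc-injective))
        next)
    where
    v : Fin r → Sign
    v j = proj₁ (B-just 0F (suc j) λ ())

    v≡ : ∀ j → B 0F (suc j) ≡ just (v j)
    v≡ j = proj₂ (B-just 0F (suc j) λ ())

    full′≡ : ∀ i → full (suc i) ≡ (c (suc i) ∷ʳ just (v i)) ++ tabulate (λ j → B (suc i) (suc j))
    full′≡ i = trans (full≡ (suc i))
      (trans (cong (λ b → c (suc i) ++ b ∷ tabulate (λ j → B (suc i) (suc j))) (trans (B-sym (suc i) 0F) (v≡ i)))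
             (sym (List.++-assoc (c (suc i)) (just (v i) ∷ []) _)))

    row≡ : c 0F ++ nothing ∷ List.map just (tabulate v) ≡ full 0F
    row≡ = sym (trans (full≡ 0F) (cong₂ (λ b bs → c 0F ++ b ∷ bs) (B-irr 0F)
             (trans (List.tabulate-cong v≡) (sym (List.map-tabulate v just)))))

    next : search r (rows ∷ʳ full 0F) (tabulate (λ i → c (suc i) ∷ʳ just (v i))) ≡ true
    next with everySigns-sound {r} _ e v
    ... | found rewrite row≡ | zipWith-tabulate (λ c s → c ∷ʳ just s) (c ∘ suc) v
      with All.all? (orthogonal? (full 0F)) rows
    ... | yes _  = found
    ... | no ¬all = contradiction (orth 0F) ¬all

-- The order matches the normalised matrix: the new vertex, the zero of the field, the four nonzero
-- squares, the four non-squares.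
vertex : Fin 10 → Maybe 𝔽₉
vertex = lookup (nothing ∷ just (0F , 0F) ∷ just (1F , 0F) ∷ just (2F , 0F) ∷ just (0F , 1F) ∷ just (0F , 2F) ∷
                 just (1F , 1F) ∷ just (1F , 2F) ∷ just (2F , 1F) ∷ just (2F , 2F) ∷ [])

nth : {A : Set} → A → List A → ℕ → A
nth d []       _       = d
nth d (x ∷ _)  zero    = x
nth d (_ ∷ xs) (suc n) = nth d xs n

nth-tabulate : {A : Set} (d : A) {n : ℕ} (f : Fin n → A) (i : Fin n) → nth d (tabulate f) (Fin.toℕ i) ≡ f i
nth-tabulate d f zero    = refl
nth-tabulate d f (suc i) = nth-tabulate d (f ∘ suc) i

entry : List Row → Fin 10 → Fin 10 → Maybe Sign
entry rows i j = nth nothing (nth [] rows (Fin.toℕ i)) (Fin.toℕ j)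

-- The positive neighbours of (0 , 0) in SP₉ are (± 1 , 0) and (0 , ± 1), and (a , b) is the only other
-- common positive neighbour of (a , 0) and (0 , b).
coordinates : (Fin 10 → Fin 10 → Maybe Sign) → Vec (Fin 10) 10
coordinates A = 0F ∷ 1F ∷ 2F ∷ a′ ∷ b ∷ b′ ∷ meet 2F b ∷ meet 2F b′ ∷ meet a′ b ∷ meet a′ b′ ∷ []
  where
  positive : Fin 10 → Fin 10 → Bool
  positive i j = does (A i j ≟ₘ just Sign.+)

  first : (Fin 10 → Bool) → List (Fin 10) → Fin 10
  -- The default `0F` is harmless, as `labels?` checks the resulting labelling.
  first p xs = fromMaybe 0F (List.head (filterᵇ p xs))

  a′ b b′ : Fin 10
  -- Vertex 2 serves as (1 , 0). Among the four nonzero squares only opposite ones are joined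
  -- positively, which singles out `a′` and pairs `b` with `b′`.
  a′ = first (positive 2F) (3F ∷ 4F ∷ 5F ∷ [])
  b  = first (not ∘ positive 2F) (3F ∷ 4F ∷ 5F ∷ [])
  b′ = first (positive b) (3F ∷ 4F ∷ 5F ∷ [])

  meet : Fin 10 → Fin 10 → Fin 10
  meet i j = first (λ k → positive i k ∧ positive j k) (6F ∷ 7F ∷ 8F ∷ 9F ∷ [])

Labels : (Fin 10 → Fin 10 → Maybe Sign) → Vec (Fin 10) 10 → Set
Labels A g = ∀ i j → A (lookup g i) (lookup g j) ≡ sign (SP₉ ⁺) (vertex i) (vertex j)

labels? : ∀ A g → Dec (Labels A g)
labels? A g = Fin.all? λ i → Fin.all? λ j → A (lookup g i) (lookup g j) ≟ₘ sign (SP₉ ⁺) (vertex i) (vertex j)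

recognise : List Row → Bool
recognise rows = does (labels? (entry rows) (coordinates (entry rows)))

open Search recognise

plus minus : Maybe Sign
plus  = just Sign.+
minus = just Sign.-

secondRow : Fin 8 → Maybe Sign
secondRow = lookup (plus ∷ plus ∷ plus ∷ plus ∷ minus ∷ minus ∷ minus ∷ minus ∷ [])

firstRows : List Row
firstRows = (nothing ∷ plus ∷ tabulate {n = 8} (λ _ → plus)) ∷ (plus ∷ nothing ∷ tabulate secondRow) ∷ []

-- Checked by evaluation: every completion of the two normalised rows that survives the
-- orthogonality tests is recognised as `SP₉ ⁺`.
search-succeeds : search 8 firstRows (tabulate (λ i → plus ∷ secondRow i ∷ [])) ≡ true
search-succeeds = refl

-- With the first two rows normalised, the remaining eight form one of the completions covered by
-- the search.
conference⇒labels : ∀ (A : Fin 10 → Fin 10 → Maybe Sign) → (∀ i j → A i j ≡ A j i) → (∀ i → A i i ≡ nothing) →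
  (∀ i j → i ≢ j → ∃[ s ] A i j ≡ just s) → (∀ i j → i ≢ j → Balanced A i j) →
  (∀ j → A 0F (suc j) ≡ plus) → (∀ j → A 1F (suc (suc j)) ≡ secondRow j) → ∃[ g ] Labels A g
conference⇒labels A A-sym A-irr A-just balanced row₀ row₁ =
  coordinates (entry rows) , λ i j → trans (sym (entry-rows _ _)) (labels i j)
  where
  rows : List Row
  rows = tabulate (λ i → tabulate (A i))

  entry-rows : ∀ i j → entry rows i j ≡ A i j
  entry-rows i j = trans (cong (λ r → nth nothing r (Fin.toℕ j)) (nth-tabulate [] (λ i → tabulate (A i)) i))
                         (nth-tabulate nothing (A i) j)

  full : Fin 8 → Row
  full i = tabulate (A (suc (suc i)))

  first≡ : firstRows ≡ tabulate (A 0F) ∷ tabulate (A 1F) ∷ []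
  first≡ = sym (cong₂ (λ x y → x ∷ y ∷ [])
    (cong₂ _∷_ (A-irr 0F) (List.tabulate-cong row₀))
    (cong₂ _∷_ (trans (A-sym 1F 0F) (row₀ 0F)) (cong₂ _∷_ (A-irr 1F) (List.tabulate-cong row₁))))

  orthogonal : ∀ i j → i ≢ j → Orthogonal (tabulate (A i)) (tabulate (A j))
  orthogonal i j i≢j = balanced⇒orthogonal A (balanced i j i≢j)

  labels : Labels (entry rows) (coordinates (entry rows))
  labels = does⇒ (labels? (entry rows) (coordinates (entry rows)))
    (subst (λ f → recognise (f ++ tabulate full) ≡ true) first≡
    (search-sound 8 firstRows (λ i → plus ∷ secondRow i ∷ []) (λ i j → A (suc (suc i)) (suc (suc j))) full
      (λ _ _ → A-sym _ _) (λ _ → A-irr _)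
      (λ _ _ i≢j → A-just _ _ (i≢j ∘ Fin.suc-injective ∘ Fin.suc-injective))
      (λ i → cong₂ (λ x y → x ∷ y ∷ tabulate (λ j → A (suc (suc i)) (suc (suc j))))
             (trans (A-sym _ 0F) (row₀ _)) (trans (A-sym _ 1F) (row₁ i)))
      (λ i → subst (All (Orthogonal (full i))) (sym first≡) (orthogonal _ _ (λ ()) ∷ orthogonal _ _ (λ ()) ∷ []))
      (λ _ _ i≢j → orthogonal _ _ (i≢j ∘ Fin.suc-injective ∘ Fin.suc-injective))
      search-succeeds))

-- Switching isomorphisms

-- Addition modulo 2. Exchanging the two twins over a vertex amounts to switching there.
twist : Fin 2 → Fin 2 → Fin 2
twist 0F j  = j
twist 1F 0F = 1F
twist 1F 1F = 0F

twist-twist : ∀ i j → twist (twist i j) i ≡ j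
twist-twist 0F 0F = refl
twist-twist 0F 1F = refl
twist-twist 1F 0F = refl
twist-twist 1F 1F = refl

twist-inverse : ∀ i j → twist i (twist j i) ≡ j
twist-inverse 0F 0F = refl
twist-inverse 0F 1F = refl
twist-inverse 1F 0F = refl
twist-inverse 1F 1F = refl

twinSign-twist : ∀ k l i j s → twinSign (twist k i) (twist l j) s ≡ twinSign k l (twinSign i j s)
twinSign-twist 0F 0F i  j  s = refl
twinSign-twist 0F 1F 0F 0F s = refl
twinSign-twist 0F 1F 0F 1F s = sym (Sign.opposite-involutive s)
twinSign-twist 0F 1F 1F 0F s = sym (Sign.opposite-involutive s)
twinSign-twist 0F 1F 1F 1F s = refl
twinSign-twist 1F 0F 0F 0F s = refl
twinSign-twist 1F 0F 0F 1F s = sym (Sign.opposite-involutive s)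
twinSign-twist 1F 0F 1F 0F s = sym (Sign.opposite-involutive s)
twinSign-twist 1F 0F 1F 1F s = refl
twinSign-twist 1F 1F 0F 0F s = refl
twinSign-twist 1F 1F 0F 1F s = refl
twinSign-twist 1F 1F 1F 0F s = refl
twinSign-twist 1F 1F 1F 1F s = refl

-- `θ` picks one vertex from each twin pair so that the chosen vertices induce `K`; the remaining
-- twins then follow. Thus `AT` is invariant under switching.
AT-≅ : {V W : Set} (H : SignifiedGraph V) (K : SignifiedGraph W) (θ : W → V × Fin 2) (inv : V → W) →
  (∀ v → proj₁ (θ (inv v)) ≡ v) → (∀ w → inv (proj₁ (θ w)) ≡ w) →
  (∀ x y → sign (AT H) (θ x) (θ y) ≡ sign K x y) → AT H ≅ AT K
AT-≅ {V} {W} H K θ inv θ∘inv inv∘θ θ-sign =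
  mk↔ₛ′ from to from∘to to∘from , λ x y → trans (sym (to-sign (from x) (from y)))
    (cong₂ (sign (AT H)) (to∘from x) (to∘from y))
  where
  to : W × Fin 2 → V × Fin 2
  to (w , k) = proj₁ (θ w) , twist k (proj₂ (θ w))

  from : V × Fin 2 → W × Fin 2
  from (v , i) = inv v , twist (proj₂ (θ (inv v))) i

  to∘from : ∀ x → to (from x) ≡ x
  to∘from (v , i) = cong₂ _,_ (θ∘inv v) (twist-twist (proj₂ (θ (inv v))) i)

  from∘to : ∀ y → from (to y) ≡ y
  from∘to (w , k) rewrite inv∘θ w = cong (w ,_) (twist-inverse (proj₂ (θ w)) k)

  to-sign : ∀ x y → sign (AT H) (to x) (to y) ≡ sign (AT K) x y
  to-sign (x , k) (y , l) = trans
    (map-twinSign-twist (sign H (proj₁ (θ x)) (proj₁ (θ y))))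
    (cong (Maybe.map (twinSign k l)) (θ-sign x y))
    where
    map-twinSign-twist : ∀ n → Maybe.map (twinSign (twist k (proj₂ (θ x))) (twist l (proj₂ (θ y)))) n
                       ≡ Maybe.map (twinSign k l) (Maybe.map (twinSign (proj₂ (θ x)) (proj₂ (θ y))) n)
    map-twinSign-twist nothing  = refl
    map-twinSign-twist (just s) = cong just (twinSign-twist k l (proj₂ (θ x)) (proj₂ (θ y)) s)

number : Maybe 𝔽₉ → Fin 10
number nothing        = 0F
number (just (a , b)) = lookup (lookup ((1F ∷ 4F ∷ 5F ∷ []) ∷ (2F ∷ 6F ∷ 7F ∷ []) ∷ (3F ∷ 8F ∷ 9F ∷ []) ∷ []) a) b

number-vertex : ∀ i → number (vertex i) ≡ i
number-vertex = from-yes (Fin.all? λ i → number (vertex i) Fin.≟ i)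

vertex-number : ∀ x → vertex (number x) ≡ x
vertex-number nothing        = refl
vertex-number (just (a , b)) = finite a b
  where
  finite : ∀ a b → vertex (number (just (a , b))) ≡ just (a , b)
  finite = from-yes (Fin.all? λ a → Fin.all? λ b →
             Maybe.≡-dec (≡-dec Fin._≟_ Fin._≟_) (vertex (number (just (a , b)))) (just (a , b)))

SP₉⁺-complete : ∀ i j → i ≢ j → sign (SP₉ ⁺) (vertex i) (vertex j) ≢ nothing
SP₉⁺-complete = from-yes (Fin.all? λ i → Fin.all? λ j →
                  ¬? (i Fin.≟ j) →-dec ¬? (sign (SP₉ ⁺) (vertex i) (vertex j) ≟ₘ nothing))

module _ (H : SignifiedGraph (Fin 10)) where

  -- `SP₉ ⁺` is complete while twins are not adjacent, so the ten labelled vertices lie in distinct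
  -- pairs and meet all of them.
  labels⇒≅ : ∀ (f : Fin 10 → Fin 10 × Fin 2) g → Labels (λ i j → sign (AT H) (f i) (f j)) g → AT H ≅ TrSP₉
  labels⇒≅ f g labels = AT-≅ H (SP₉ ⁺) (h ∘ number) (vertex ∘ proj₁ ∘ surjective)
    (λ v → trans (cong (proj₁ ∘ h) (number-vertex _)) (proj₂ (surjective v)))
    (λ x → trans (cong vertex (injective (proj₂ (surjective _)))) (vertex-number x))
    (λ x y → trans (labels (number x) (number y)) (cong₂ (sign (SP₉ ⁺)) (vertex-number x) (vertex-number y)))
    where
    h : Fin 10 → Fin 10 × Fin 2
    h = f ∘ lookup g

    injective : Injective _≡_ _≡_ (proj₁ ∘ h)
    injective {i} {j} e with i Fin.≟ j
    ... | yes i≡j = i≡j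
    ... | no i≢j  = contradiction (trans (sym (labels i j)) (same-base (h i) (h j) e)) (SP₉⁺-complete i j i≢j)
      where
      same-base : ∀ x y → proj₁ x ≡ proj₁ y → sign (AT H) x y ≡ nothing
      same-base (x , i) (_ , j) refl = cong (Maybe.map (twinSign i j)) (SignifiedGraph.loopless H x)

    surjective = injective⇒surjective injective

  -- The frame on a positive edge is normalised: all its other vertices are positive neighbours of
  -- `v`, and the ribs are sorted by their sign towards `u`.
  pair⇒≅ : ∀ {k v u} → sign (AT H) v u ≡ just Sign.+ → Pair H (suc (suc (suc k))) v u → AT H ≅ TrSP₉
  pair⇒≅ {k} {v} {u} v~u pr@(pair e filled) = labels⇒≅ frame (proj₁ labels) (proj₂ labels)
    where
    open Frame H {suc (suc k)} v~u (ribs H {suc (suc k)} filled)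

    A : Fin 10 → Fin 10 → Maybe Sign
    A i j = sign (AT H) (frame i) (frame j)

    link : ∀ i j → i ≢ j → Linked H (proj₁ (frame i)) (proj₁ (frame j))
    link i j i≢j = allLinked H pr _ _ (i≢j ∘ frame-injective)

    A-just : ∀ i j → i ≢ j → ∃[ s ] A i j ≡ just s
    A-just i j i≢j with (s , e) , _ ← link i j i≢j =
      twinSign (proj₂ (frame i)) (proj₂ (frame j)) s , cong (Maybe.map _) e

    -- Replacing vertices of `H` by chosen twins multiplies all products of two rows by one sign,
    -- given by `τ`, so the two classes of four are at most exchanged.
    A-balanced : ∀ i j → i ≢ j → Balanced A i j
    A-balanced i j i≢j s =
      κ , (λ {a} {b} e → proj₁ (proj₂ four′) (trans (sym (κ≡ a)) (trans (cong (proj₁ ∘ frame) e) (κ≡ b)))) , λ a → begin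
        A i (κ a) ⊙ A j (κ a)
          ≡⟨ twin-⊙ (proj₂ (frame i)) (proj₂ (frame j)) (proj₂ (frame (κ a)))
                    (sign H (proj₁ (frame i)) (proj₁ (frame (κ a)))) (sign H (proj₁ (frame j)) (proj₁ (frame (κ a)))) ⟩
        Maybe.map τ (sign H (proj₁ (frame i)) (proj₁ (frame (κ a))) ⊙ sign H (proj₁ (frame j)) (proj₁ (frame (κ a))))
          ≡⟨ cong (λ x → Maybe.map τ (sign H (proj₁ (frame i)) x ⊙ sign H (proj₁ (frame j)) x)) (κ≡ a) ⟩
        Maybe.map τ (sign H (proj₁ (frame i)) (z a) ⊙ sign H (proj₁ (frame j)) (z a))
          ≡⟨ cong (Maybe.map τ) (proj₂ (proj₂ four′) a) ⟩
        just (τ (τ s))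
          ≡⟨ cong just (twinSign-involutive (proj₂ (frame i)) (proj₂ (frame j)) s) ⟩
        just s ∎
      where
      open ≡-Reasoning
      τ = twinSign (proj₂ (frame i)) (proj₂ (frame j))
      four′ = proj₂ (link i j i≢j) (τ s)
      z = proj₁ four′
      κ : Fin 4 → Fin 10
      κ a = proj₁ (frame-surjective (z a))
      κ≡ : ∀ a → proj₁ (frame (κ a)) ≡ z a
      κ≡ a = proj₂ (frame-surjective (z a))

    row₀ : ∀ j → A 0F (suc j) ≡ plus
    row₀ zero    = v~u
    row₀ (suc j) = v~r _ _

    row₁ : ∀ j → A 1F (suc (suc j)) ≡ secondRow j
    row₁ j = trans (u~r _ _) (signs j)
      where
      signs : ∀ j → just (proj₁ (rib j)) ≡ secondRow j
      signs = from-yes (Fin.all? λ j → just (proj₁ (rib j)) ≟ₘ secondRow j)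

    labels : ∃[ g ] Labels A g
    labels = conference⇒labels A
      (λ i j → SignifiedGraph.symmetric (AT H) (frame i) (frame j)) (λ i → SignifiedGraph.loopless (AT H) (frame i))
      A-just A-balanced row₀ row₁

  planar⇒≅ : ((n : ℕ) (G : SignifiedGraph (Fin n)) → Planar (underlying G) → G ⟶ AT H) → AT H ≅ TrSP₉
  planar⇒≅ universal
    -- The outer corners are not joined to each other, so a fan with a single vertex supplies the
    -- positive edge that carries a gadget. Its depth 3 is what `allLinked` consumes.
    with c , f ← planar⇒fills (AT H) universal (fan (gadget 3) ((Sign.+ , Sign.+) ∷ []))
    with d , _ , (v~d , _ , filled , _) , _ ← fan⇒run (AT H) (gadget 3) ((Sign.+ , Sign.+) ∷ []) c f =
    pair⇒≅ v~d (pair v~d filled)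

-- Anti-twinned targets on 20 vertices

≅-trans : {U V W : Set} {G : SignifiedGraph U} {H : SignifiedGraph V} {K : SignifiedGraph W} → G ≅ H → H ≅ K → G ≅ K
≅-trans (φ , φ-sign) (ψ , ψ-sign) = ↔-trans φ ψ , λ x y →
  trans (ψ-sign (Inverse.to φ x) (Inverse.to φ y)) (φ-sign x y)

↔⇒≡ : ∀ {m n} → Fin m ↔ Fin n → m ≡ n
↔⇒≡ φ = Fin.cantor-schröder-bernstein (Injection.injective (↔⇒↣ φ)) (Injection.injective (↔⇒↣ (↔-sym φ)))

mainTheorem15 : (H₂₀ : SignifiedGraph (Fin 20)) → AntiTwinned H₂₀ →
    ((n : ℕ) (G : SignifiedGraph (Fin n)) → Planar (underlying G) → G ⟶ H₂₀) →
    H₂₀ ≅ TrSP₉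
mainTheorem15 H₂₀ (m , H , φ , φ-sign) universal
  -- Counting vertices gives 20 = 2 m, so `H` has order 10.
  with refl ← ℕ.*-cancelʳ-≡ 10 m 2 (↔⇒≡ (↔-trans φ (↔-sym Fin.*↔×))) =
  ≅-trans {G = H₂₀} {H = AT H} {K = TrSP₉} (φ , φ-sign) (planar⇒≅ H λ n G planar →
    let f , f-sign = universal n G planar in
    Inverse.to φ ∘ f , λ x y s e → trans (φ-sign (f x) (f y)) (f-sign x y s e))
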